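{- There is a deterministic two-pass streaming algorithm that, given a graph stream of a connected weighted graph $G$ on $n$ vertices, uses $\tilde O(n)$ space and outputs a value $X$ with $\mathsf{TSP}(G)\le X\le 1.96\cdot\mathsf{TSP}(G)$.
   Context: A graph stream of a weighted graph $G$ is a stream of its edges with their weights, in arbitrary order (the same in both passes). $\mathsf{TSP}(G)$ denotes the minimum weight of a Hamiltonian cycle in the shortest-path metric induced by $G$. $\tilde O$ hides polylogarithmic factors in $n$.
   Formalization: Edge weights are nonnegative rationals instead of reals; space is counted as the machine words (each holding a vertex name or a weight's numerator or denominator) kept between stream edges and between passes. -}

module Defs where

open import Data.Bool.Base using (Bool)
open import Data.Fin.Base using (Fin; suc; toℕ)
open import Data.Fin.Permutation using (Permutation′; _⟨$⟩ʳ_)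
open import Data.Integer.Base using (∣_∣)
open import Data.List.Base using (List; foldl; allFin)
open import Data.List.Membership.Propositional using (_∈_)
open import Data.List.Relation.Unary.All using (All)
open import Data.List.Relation.Unary.AllPairs using (AllPairs)
open import Data.Maybe.Base using (Maybe; just; nothing)
open import Data.Nat.Base as ℕ using (ℕ; suc; _*_; _^_)
open import Data.Nat.DivMod using (_mod_)
open import Data.Nat.Logarithm using (⌈log₂_⌉)
open import Data.Product.Base using (∃-syntax; _×_; _,_)
open import Data.Rational.Base as ℚ using (ℚ; 0ℚ; ↥_; ↧ₙ_)
open import Data.Rational.Properties using (+-0-commutativeMonoid)
open import Data.Sum.Base using (_⊎_)
open import Data.Vec.Base using (Vec)
open import Relation.Binary.Construct.Closure.ReflexiveTransitive using (Star; ε; _◅_)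
open import Relation.Binary.PropositionalEquality using (_≡_)
open import Relation.Nullary.Negation.Core using (¬_)

open import Algebra.Properties.CommutativeMonoid.Sum +-0-commutativeMonoid using (sum)

------------------------------------------------------------------------
-- Weighted graphs

-- Finite, simple and undirected; weight u v ≡ nothing means that u and v
-- are not adjacent.

record WeightedGraph (n : ℕ) : Set where
  field
    weight       : Fin n → Fin n → Maybe ℚ
    symmetric    : ∀ u v → weight u v ≡ weight v u
    loopless     : ∀ u → weight u u ≡ nothing
    non-negative : ∀ u v q → weight u v ≡ just q → 0ℚ ℚ.≤ q

open WeightedGraph public

module _ {n : ℕ} (G : WeightedGraph n) where

  Adjacent : Fin n → Fin n → Set
  Adjacent u v = ∃[ q ] weight G u v ≡ just q

  Walk : Fin n → Fin n → Set
  Walk = Star Adjacent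

  Connected : Set
  Connected = ∀ u v → Walk u v

  walkWeight : ∀ {u v} → Walk u v → ℚ
  walkWeight ε             = 0ℚ
  walkWeight ((q , _) ◅ p) = q ℚ.+ walkWeight p

------------------------------------------------------------------------
-- The travelling salesman value

-- m is the (attained) minimum of f.

IsMinimumOf : {A : Set} → (A → ℚ) → ℚ → Set
IsMinimumOf f m = (∃[ a ] f a ≡ m) × (∀ a → m ℚ.≤ f a)

IsShortestPathMetric : ∀ {n} → WeightedGraph n → (Fin n → Fin n → ℚ) → Set
IsShortestPathMetric G d = ∀ u v → IsMinimumOf (walkWeight G {u} {v}) (d u v)

cyclicSuc : ∀ {n} → Fin n → Fin n
cyclicSuc {suc n} i = suc (toℕ i) mod suc n

-- A Hamiltonian cycle of the complete graph on Fin n is given by the order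
-- π 0, π 1, …, π (n-1), π 0 in which it visits the vertices.  For n = 2 it
-- traverses the only edge in both directions; for n = 1 it has weight d 0 0.

tourWeight : ∀ {n} → (Fin n → Fin n → ℚ) → Permutation′ n → ℚ
tourWeight d π = sum (λ i → d (π ⟨$⟩ʳ i) (π ⟨$⟩ʳ cyclicSuc i))

-- t = TSP(G)

IsTSP : ∀ {n} → WeightedGraph n → ℚ → Set
IsTSP G t = ∃[ d ] IsShortestPathMetric G d × IsMinimumOf (tourWeight d) t

------------------------------------------------------------------------
-- Graph streams

record StreamEdge (n : ℕ) : Set where
  constructor edge
  field
    src tgt : Fin n
    wt      : ℚ

open StreamEdge public

SameEnds : ∀ {n} → StreamEdge n → StreamEdge n → Set
SameEnds e f = (src e ≡ src f × tgt e ≡ tgt f) ⊎ (src e ≡ tgt f × tgt e ≡ src f)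

-- Every edge of G appears exactly once, in one of its two orientations, and
-- nothing else appears.

record IsGraphStream {n : ℕ} (G : WeightedGraph n) (σ : List (StreamEdge n)) : Set where
  field
    sound    : All (λ e → weight G (src e) (tgt e) ≡ just (wt e)) σ
    complete : ∀ u v q → weight G u v ≡ just q → edge u v q ∈ σ ⊎ edge v u q ∈ σ
    distinct : AllPairs (λ e f → ¬ SameEnds e f) σ

------------------------------------------------------------------------
-- Streaming algorithms

-- A machine word has room for a vertex name and an ω-bit integer.

Word : (n ω : ℕ) → Set
Word n ω = Vec Bool (⌈log₂ n ⌉ ℕ.+ ω)

-- A weight consists of two ω-bit integers, its numerator and denominator.

WeightsFit : ∀ {n} → ℕ → WeightedGraph n → Set
WeightsFit ω G = ∀ u v q → weight G u v ≡ just q →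
  ∣ ↥ q ∣ ℕ.< 2 ^ ω × ↧ₙ q ℕ.< 2 ^ ω

-- A deterministic algorithm making p passes over the stream with s words of
-- memory.  The memory is everything that is remembered from one stream edge
-- to the next, and from one pass to the next.

record StreamingAlgorithm (p s n ω : ℕ) : Set where
  Memory : Set
  Memory = Vec (Word n ω) s

  field
    start  : Memory
    step   : Fin p → Memory → StreamEdge n → Memory
    output : Memory → ℚ

  pass : List (StreamEdge n) → Memory → Fin p → Memory
  pass σ m i = foldl (step i) m σ

  run : List (StreamEdge n) → ℚ
  run σ = output (foldl (pass σ) start (allFin p))

open StreamingAlgorithm public using (run)

-- f = Õ(g): f is at most g up to a constant and a power of log n.  The
-- summand 1 only matters for n ≤ 1, where the logarithm vanishes.

infix 4 _∈Õ_

_∈Õ_ : (ℕ → ℕ) → (ℕ → ℕ) → Set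
f ∈Õ g = ∃[ C ] ∃[ k ] ∀ n → f n ℕ.≤ C * g n * (1 ℕ.+ ⌈log₂ n ⌉) ^ k

{-# OPTIONS --safe #-}

-- Let T be a minimum spanning tree.  The first pass computes T by Kruskal's
-- algorithm on T and each new edge.  The second pass collects edges F greedily:
-- f is kept if the tree edges on its tree path that no earlier edge of F covers
-- weigh more than 7/5 times f.  Each kept edge covers a new tree edge, so
-- |F| < n.  The output is X = ½ (3 w(T) + w(U) + w(F)), where U is the set of
-- uncovered tree edges.
--
-- TSP ≤ X: for S ⊆ F add to T ∪ S a second copy of each tree edge that S covers
-- an even number of times; this has an Euler tour.  A covered tree edge is
-- doubled for exactly half of the subsets S, so the average cost is
-- w(T) + w(U) + ½ w(T ∖ U) + ½ w(F) = X.
--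
-- X ≤ 1.96 TSP: a closed walk through all vertices crosses each fundamental cut
-- of T twice, and each edge of the stream crosses uncovered cuts of weight at
-- most 7/5 times its own, so 2 w(U) ≤ 7/5 TSP.  Moreover 7/5 w(F) ≤ w(T ∖ U)
-- and w(T) ≤ TSP.
module Submission where

open import Defs
open import Algebra.Bundles using (CommutativeRing)
open import Algebra.Structures using (IsCommutativeMonoid)
open import Data.Bool.Base using (Bool; true; false; if_then_else_; _xor_; _∨_; not)
open import Data.Bool.ListAction using (any)
import Data.Bool.Properties as Bool
open import Data.Bool.Properties using (xor-∧-commutativeRing; xor-same; xor-assoc; xor-comm; not-involutive; T?)
open import Data.Empty using (⊥-elim)
open import Data.Fin.Base as Fin using (Fin; toℕ; fromℕ; fromℕ<; inject₁)
open import Data.Fin.Permutation using (Permutation; _⟨$⟩ʳ_; _⟨$⟩ˡ_; permutation; ↔⇒≡; inverseʳ)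
import Data.Fin.Properties as Fin
open import Data.Fin.Properties using (_≟_)
open import Data.Integer.Base as ℤ using ()
open import Data.List.Base using (List; []; _∷_; _++_; length; map; lookup; filterᵇ; foldl)
import Data.List.Membership.DecPropositional as DecMembership
open import Data.List.Membership.Propositional using (_∈_; _∉_; lose; find)
open import Data.List.Membership.Propositional.Properties using (∈-++⁺ˡ; ∈-++⁺ʳ; ∈-++⁻; ∈-lookup; ∈-∃++; ∈-map⁺; ∈-map⁻)
open import Data.List.Properties using (++-assoc; ++-identityʳ; map-∘; length-map)
open import Data.List.Relation.Binary.Permutation.Propositional as ↭ using (_↭_)
import Data.List.Relation.Binary.Permutation.Propositional.Properties as ↭
open import Data.List.Relation.Binary.Subset.Propositional using (_⊆_)
open import Data.List.Relation.Unary.All as All using (All; []; _∷_)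
import Data.List.Relation.Unary.All.Properties as All
open import Data.List.Relation.Unary.AllPairs using (AllPairs; []; _∷_)
import Data.List.Relation.Unary.AllPairs.Properties as AllPairs
open import Data.List.Relation.Unary.Any as Any using (Any; here; there; any?; index)
open import Data.List.Relation.Unary.Any.Properties using (lookup-index)
open import Data.List.Relation.Unary.Unique.Propositional using (Unique)
open import Data.Maybe.Base using (Maybe; just; nothing)
open import Data.Nat.Base as ℕ using (ℕ; suc; zero; s≤s; z≤n; _^_; ⌈_/2⌉)
import Data.Nat.DivMod as ℕ
open import Data.Nat.Induction using (<-rec)
open import Data.Nat.Logarithm using (⌈log₂_⌉; ⌈log₂⌉-mono-≤; ⌈log₂⌈n/2⌉⌉≡⌈log₂n⌉∸1)
import Data.Nat.Properties as ℕ
open import Data.Product.Base using (∃-syntax; Σ-syntax; _×_; _,_; proj₁; proj₂)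
open import Data.Rational.Base as ℚ using (ℚ; 0ℚ; ½; _+_; _*_; _≤_; _<_; _/_; ↥_; ↧ₙ_; mkℚ)
import Data.Rational.Properties as ℚ
open import Data.Rational.Solver using (module +-*-Solver)
open import Data.Sum.Base as Sum using (_⊎_; inj₁; inj₂; [_,_]′)
open import Data.Unit.Base using (⊤; tt)
open import Data.Vec.Base as Vec using (Vec; []; _∷_)
import Data.Vec.Properties as Vec
open import Function.Base using (_∘_; id)
open import Relation.Binary.Construct.Closure.ReflexiveTransitive using (ε; _◅_; _◅◅_)
open import Relation.Binary.PropositionalEquality
open import Relation.Nullary using (¬_; Dec; yes; no; does; contradiction; ¬?; decidable-stable; map′; _×-dec_; _⊎-dec_)
open import Relation.Nullary.Decidable using (dec-true; dec-false)
open import Algebra.Properties.CommutativeMonoid.Sum ℚ.+-0-commutativeMonoid using (sum; sum-cong-≗; sum-init-last)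

module ListSum {A : Set} {_∙_ : A → A → A} {ε : A}
               (M : IsCommutativeMonoid _≡_ _∙_ ε) where

  open IsCommutativeMonoid M using (assoc; comm; identityˡ; identityʳ)
  open ≡-Reasoning

  ∑ : {B : Set} → List B → (B → A) → A
  ∑ []       f = ε
  ∑ (x ∷ xs) f = f x ∙ ∑ xs f

  medial : ∀ a b c d → (a ∙ b) ∙ (c ∙ d) ≡ (a ∙ c) ∙ (b ∙ d)
  medial a b c d = begin
    (a ∙ b) ∙ (c ∙ d)  ≡⟨ assoc a b (c ∙ d) ⟩
    a ∙ (b ∙ (c ∙ d))  ≡⟨ cong (a ∙_) (assoc b c d) ⟨
    a ∙ ((b ∙ c) ∙ d)  ≡⟨ cong (λ z → a ∙ (z ∙ d)) (comm b c) ⟩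
    a ∙ ((c ∙ b) ∙ d)  ≡⟨ cong (a ∙_) (assoc c b d) ⟩
    a ∙ (c ∙ (b ∙ d))  ≡⟨ assoc a c (b ∙ d) ⟨
    (a ∙ c) ∙ (b ∙ d)  ∎

  module _ {B : Set} where

    ∑-cong : ∀ xs {f g : B → A} → (∀ {x} → x ∈ xs → f x ≡ g x) → ∑ xs f ≡ ∑ xs g
    ∑-cong []       h = refl
    ∑-cong (x ∷ xs) h = cong₂ _∙_ (h (here refl)) (∑-cong xs (h ∘ there))

    ∑-ε : ∀ (xs : List B) → ∑ xs (λ _ → ε) ≡ ε
    ∑-ε []       = refl
    ∑-ε (x ∷ xs) = trans (identityˡ _) (∑-ε xs)

    ∑-∙ : ∀ xs (f g : B → A) → ∑ xs (λ x → f x ∙ g x) ≡ ∑ xs f ∙ ∑ xs g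
    ∑-∙ []       f g = sym (identityˡ ε)
    ∑-∙ (x ∷ xs) f g =
      trans (cong ((f x ∙ g x) ∙_) (∑-∙ xs f g)) (medial (f x) (g x) _ _)

    ∑-++ : ∀ xs ys (f : B → A) → ∑ (xs ++ ys) f ≡ ∑ xs f ∙ ∑ ys f
    ∑-++ []       ys f = sym (identityˡ _)
    ∑-++ (x ∷ xs) ys f = trans (cong (f x ∙_) (∑-++ xs ys f)) (sym (assoc _ _ _))

    ∑-if-none : ∀ xs (p : B → Bool) (f : B → A) → All (λ x → p x ≡ false) xs →
                ∑ xs (λ x → if p x then f x else ε) ≡ ε
    ∑-if-none []       p f []       = refl
    ∑-if-none (x ∷ xs) p f (e ∷ es) rewrite e = trans (identityˡ _) (∑-if-none xs p f es)

    ∑-filter : ∀ (p : B → Bool) xs (f : B → A) →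
               ∑ (filterᵇ p xs) f ≡ ∑ xs (λ x → if p x then f x else ε)
    ∑-filter p []       f = refl
    ∑-filter p (x ∷ xs) f with p x
    ... | true  = cong (f x ∙_) (∑-filter p xs f)
    ... | false = trans (∑-filter p xs f) (sym (identityˡ _))

    ∑-↭ : ∀ {xs ys} → xs ↭ ys → ∀ (f : B → A) → ∑ xs f ≡ ∑ ys f
    ∑-↭ ↭.refl          f = refl
    ∑-↭ (↭.prep x r)    f = cong (f x ∙_) (∑-↭ r f)
    ∑-↭ {_ ∷ _ ∷ xs} {_ ∷ _ ∷ ys} (↭.swap x y r) f = begin
      f x ∙ (f y ∙ ∑ xs f)  ≡⟨ assoc (f x) (f y) _ ⟨
      (f x ∙ f y) ∙ ∑ xs f  ≡⟨ cong₂ _∙_ (comm (f x) (f y)) (∑-↭ r f) ⟩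
      (f y ∙ f x) ∙ ∑ ys f  ≡⟨ assoc (f y) (f x) _ ⟩
      f y ∙ (f x ∙ ∑ ys f)  ∎
    ∑-↭ (↭.trans r r′)  f = trans (∑-↭ r f) (∑-↭ r′ f)

  ∑-map : ∀ {B C : Set} (h : B → C) xs (f : C → A) → ∑ (map h xs) f ≡ ∑ xs (f ∘ h)
  ∑-map h []       f = refl
  ∑-map h (x ∷ xs) f = cong (f (h x) ∙_) (∑-map h xs f)

  ∑-swap : ∀ {B C : Set} xs ys (f : B → C → A) →
           ∑ xs (λ x → ∑ ys (f x)) ≡ ∑ ys (λ y → ∑ xs (λ x → f x y))
  ∑-swap []       ys f = sym (∑-ε ys)
  ∑-swap (x ∷ xs) ys f =
    trans (cong (∑ ys (f x) ∙_) (∑-swap xs ys f)) (sym (∑-∙ ys (f x) _))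

open ListSum ℚ.+-0-isCommutativeMonoid

∑-mono : ∀ {B : Set} (xs : List B) {f g : B → ℚ} →
         (∀ {x} → x ∈ xs → f x ≤ g x) → ∑ xs f ≤ ∑ xs g
∑-mono []       h = ℚ.≤-refl
∑-mono (x ∷ xs) h = ℚ.+-mono-≤ (h (here refl)) (∑-mono xs (h ∘ there))

∑-nonneg : ∀ {B : Set} (xs : List B) {f : B → ℚ} → (∀ {x} → x ∈ xs → 0ℚ ≤ f x) → 0ℚ ≤ ∑ xs f
∑-nonneg xs h = ℚ.≤-trans (ℚ.≤-reflexive (sym (∑-ε xs))) (∑-mono xs h)

weightOf : ∀ {n} → List (StreamEdge n) → ℚ
weightOf L = ∑ L wt

lookup-injective : ∀ {A : Set} {xs : List A} → Unique xs → ∀ {i j} →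
                   lookup xs i ≡ lookup xs j → i ≡ j
lookup-injective (a ∷ u) {Fin.zero}  {Fin.zero}  eq = refl
lookup-injective (a ∷ u) {Fin.zero}  {Fin.suc j} eq = contradiction eq (All.lookup a (∈-lookup j))
lookup-injective (a ∷ u) {Fin.suc i} {Fin.zero}  eq = contradiction (sym eq) (All.lookup a (∈-lookup i))
lookup-injective (a ∷ u) {Fin.suc i} {Fin.suc j} eq = cong Fin.suc (lookup-injective u eq)

-- Connectivity

merge : ∀ {n} → Fin n → Fin n → Fin n → Fin n
merge u v x = if does (x ≟ u) then v else x

-- label L x is a canonical representative of the component of x in (Fin n , L).

label : ∀ {n} → List (StreamEdge n) → Fin n → Fin n
label []      x = x
label (e ∷ L) x = merge (label L (src e)) (label L (tgt e)) (label L x)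

module _ {n : ℕ} where

  merge-source : ∀ (u v : Fin n) → merge u v u ≡ v
  merge-source u v with u ≟ u
  ... | yes _  = refl
  ... | no u≢u = contradiction refl u≢u

  merge-target : ∀ (u v : Fin n) → merge u v v ≡ v
  merge-target u v with v ≟ u
  ... | yes _ = refl
  ... | no  _ = refl

  merge-cases : ∀ (u v x : Fin n) → x ≡ u ⊎ merge u v x ≡ x
  merge-cases u v x with x ≟ u
  ... | yes x≡u = inj₁ x≡u
  ... | no  _   = inj₂ refl

  merge-≢ : ∀ (u v x : Fin n) → u ≢ v → merge u v x ≢ u
  merge-≢ u v x u≢v eq with x ≟ u
  ... | yes _   = u≢v (sym eq)
  ... | no  x≢u = x≢u eq

  Constant : {A : Set} → (Fin n → A) → Set
  Constant g = ∀ x y → g x ≡ g y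

  Respects : {A : Set} → (Fin n → A) → StreamEdge n → Set
  Respects g e = g (src e) ≡ g (tgt e)

  label-respects : ∀ L → All (Respects (label L)) L
  label-respects []      = []
  label-respects (e ∷ L) =
    trans (merge-source u v) (sym (merge-target u v)) ∷
    All.map (cong (merge _ _)) (label-respects L)
    where
    u = label L (src e)
    v = label L (tgt e)

  label-universal : ∀ {A : Set} (g : Fin n → A) L → All (Respects g) L → ∀ x → g (label L x) ≡ g x
  label-universal g []      []       x = refl
  label-universal g (e ∷ L) (r ∷ rs) x
    with label L x ≟ label L (src e)
  ... | no  _  = label-universal g L rs x
  ... | yes eq = begin
    g (label L (tgt e)) ≡⟨ label-universal g L rs (tgt e) ⟩
    g (tgt e)           ≡⟨ r ⟨
    g (src e)           ≡⟨ label-universal g L rs (src e) ⟨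
    g (label L (src e)) ≡⟨ cong g eq ⟨
    g (label L x)       ≡⟨ label-universal g L rs x ⟩
    g x                 ∎
    where open ≡-Reasoning

  label-joined : ∀ {A : Set} (g : Fin n → A) {L x y} → All (Respects g) L →
                 label L x ≡ label L y → g x ≡ g y
  label-joined g {L} rs eq =
    trans (sym (label-universal g L rs _)) (trans (cong g eq) (label-universal g L rs _))

  Spanning : List (StreamEdge n) → Set
  Spanning L = Constant (label L)

  spanning⇒constant : ∀ {A : Set} {L} → Spanning L → (g : Fin n → A) →
                      All (Respects g) L → Constant g
  spanning⇒constant sp g rs x y = label-joined g rs (sp x y)

  spanning-⊆ : ∀ {L L′} → L ⊆ L′ → Spanning L → Spanning L′
  spanning-⊆ L⊆L′ sp =
    spanning⇒constant sp _ (All.tabulate (All.lookup (label-respects _) ∘ L⊆L′))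

  Separates : List (StreamEdge n) → StreamEdge n → Set
  Separates L e = label L (src e) ≢ label L (tgt e)

  separates? : ∀ L e → Dec (Separates L e)
  separates? L e = ¬? (label L (src e) ≟ label L (tgt e))

  not-separated : ∀ {L e} → ¬ Separates L e → Respects (label L) e
  not-separated = decidable-stable (_ ≟ _)

  -- Exchange: if Z together with a is spanning, then Z has at most two
  -- components, so any edge leaving one of them can take the place of a.

  spanning-exchange : ∀ {Z a e} → Separates Z e → Spanning (a ∷ Z) → Spanning (e ∷ Z)
  spanning-exchange {Z} {a} {e} sep sp =
    λ x y → trans (collapse x) (sym (collapse y))
    where
    u = label Z (src a)
    v = label Z (tgt a)
    h = label (e ∷ Z)

    two : ∀ x → label Z x ≡ u ⊎ label Z x ≡ v
    two x with merge-cases u v (label Z x)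
    ... | inj₁ eq = inj₁ eq
    ... | inj₂ eq = inj₂ (trans (sym eq) (trans (sp x (src a)) (merge-source u v)))

    he : h (src e) ≡ h (tgt e)
    he = All.head (label-respects (e ∷ Z))

    huv : merge (label Z (src e)) (label Z (tgt e)) u ≡ merge (label Z (src e)) (label Z (tgt e)) v
    huv with two (src e) | two (tgt e)
    ... | inj₁ p | inj₁ q = contradiction (trans p (sym q)) sep
    ... | inj₁ p | inj₂ q = trans (cong (merge _ _) (sym p)) (trans he (cong (merge _ _) q))
    ... | inj₂ p | inj₁ q = trans (cong (merge _ _) (sym q)) (trans (sym he) (cong (merge _ _) p))
    ... | inj₂ p | inj₂ q = contradiction (trans p (sym q)) sep

    collapse : ∀ x → h x ≡ merge (label Z (src e)) (label Z (tgt e)) u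
    collapse x with two x
    ... | inj₁ p = cong (merge _ _) p
    ... | inj₂ p = trans (cong (merge _ _) p) (sym huv)

  -- Minimum spanning forests

  Replaceable : List (StreamEdge n) → StreamEdge n → Set
  Replaceable T a = ∀ Z → Spanning (a ∷ Z) →
    ∃[ B ] B ⊆ T × Spanning (B ++ Z) × weightOf B ≤ wt a

  replaceable-∈ : ∀ {T a} → a ∈ T → Replaceable T a
  replaceable-∈ {a = a} a∈T Z sp =
    a ∷ [] , (λ { (here refl) → a∈T }) , sp , ℚ.≤-reflexive (ℚ.+-identityʳ (wt a))

  replaceable-⊆ : ∀ {T T′ a} → T ⊆ T′ → Replaceable T a → Replaceable T′ a
  replaceable-⊆ T⊆T′ r Z sp with r Z sp
  ... | B , B⊆T , spB , le = B , T⊆T′ ∘ B⊆T , spB , le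

  ++-exchange : ∀ (A B : List (StreamEdge n)) {Z} → A ++ (B ++ Z) ⊆ B ++ (A ++ Z)
  ++-exchange A B x∈ with ∈-++⁻ A x∈
  ... | inj₁ x∈A = ∈-++⁺ʳ B (∈-++⁺ˡ x∈A)
  ... | inj₂ x∈BZ with ∈-++⁻ B x∈BZ
  ...   | inj₁ x∈B = ∈-++⁺ˡ x∈B
  ...   | inj₂ x∈Z = ∈-++⁺ʳ B (∈-++⁺ʳ A x∈Z)

  replaceable-list : ∀ {T} B → All (Replaceable T) B → ∀ Z → Spanning (B ++ Z) →
    ∃[ B′ ] B′ ⊆ T × Spanning (B′ ++ Z) × weightOf B′ ≤ weightOf B
  replaceable-list []      []       Z sp = [] , (λ ()) , sp , ℚ.≤-refl
  replaceable-list (b ∷ B) (r ∷ rs) Z sp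
    with C , C⊆T , spC , leC ← r (B ++ Z) sp
    with B′ , B′⊆T , spB′ , leB′ ←
           replaceable-list B rs (C ++ Z) (spanning-⊆ (++-exchange C B) spC)
    = C ++ B′ , [ C⊆T , B′⊆T ]′ ∘ ∈-++⁻ C
    , subst Spanning (sym (++-assoc C B′ Z)) (spanning-⊆ (++-exchange B′ C) spB′)
    , ℚ.≤-trans (ℚ.≤-reflexive (∑-++ C B′ wt)) (ℚ.+-mono-≤ leC leB′)

  replaceable-trans : ∀ {T T′ a} → Replaceable T a → All (Replaceable T′) T → Replaceable T′ a
  replaceable-trans r rs Z sp
    with B , B⊆T , spB , le ← r Z sp
    with B′ , B′⊆T′ , spB′ , le′ ← replaceable-list B (All.tabulate (All.lookup rs ∘ B⊆T)) Z spB
    = B′ , B′⊆T′ , spB′ , ℚ.≤-trans le′ le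

  replaceable-joined : ∀ {L a} → 0ℚ ≤ wt a → All (λ e → wt e ≤ wt a) L →
                       ¬ Separates L a → Replaceable L a
  replaceable-joined {L} {a} 0≤a light ¬sep Z sp with any? (separates? Z) L
  ... | yes some with e , e∈L , sepe ← find some =
    e ∷ [] , (λ { (here refl) → e∈L }) , spanning-exchange {Z} {a} {e} sepe sp
    , ℚ.≤-trans (ℚ.≤-reflexive (ℚ.+-identityʳ (wt e))) (All.lookup light e∈L)
  ... | no none =
    [] , (λ ()) , spanning⇒constant {L = a ∷ Z} sp (label Z) (a-joined ∷ label-respects Z) , 0≤a
    where
    a-joined : Respects (label Z) a
    a-joined = label-joined (label Z)
      (All.map (λ {e} → not-separated {Z} {e}) (All.¬Any⇒All¬ L none))
      (not-separated {L} {a} ¬sep)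

  Descending : List (StreamEdge n) → Set
  Descending = AllPairs (λ e f → wt f ≤ wt e)

  Independent : List (StreamEdge n) → Set
  Independent []      = ⊤
  Independent (e ∷ L) = Separates L e × Independent L

  -- Kruskal's algorithm on a list whose lightest edge comes last.

  prune : List (StreamEdge n) → List (StreamEdge n)
  prune []      = []
  prune (e ∷ L) with separates? (prune L) e
  ... | yes _ = e ∷ prune L
  ... | no  _ = prune L

  prune-⊆ : ∀ L → prune L ⊆ L
  prune-⊆ (e ∷ L) x∈ with separates? (prune L) e
  prune-⊆ (e ∷ L) (here eq)  | yes _ = here eq
  prune-⊆ (e ∷ L) (there x∈) | yes _ = there (prune-⊆ L x∈)
  prune-⊆ (e ∷ L) x∈         | no  _ = there (prune-⊆ L x∈)

  prune-independent : ∀ L → Independent (prune L)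
  prune-independent []      = tt
  prune-independent (e ∷ L) with separates? (prune L) e
  ... | yes sep = sep , prune-independent L
  ... | no  _   = prune-independent L

  prune-descending : ∀ {L} → Descending L → Descending (prune L)
  prune-descending []               = []
  prune-descending {e ∷ L} (d ∷ ds) with separates? (prune L) e
  ... | yes _ = All.tabulate (All.lookup d ∘ prune-⊆ L) ∷ prune-descending ds
  ... | no  _ = prune-descending ds

  prune-replaceable : ∀ {L} → All (λ e → 0ℚ ≤ wt e) L → Descending L →
                      All (Replaceable (prune L)) L
  prune-replaceable []       []                 = []
  prune-replaceable {e ∷ L} (p ∷ ps) (d ∷ ds) with separates? (prune L) e
  ... | yes _   = replaceable-∈ (here refl) ∷
                  All.map (λ {a} → replaceable-⊆ {a = a} there) (prune-replaceable ps ds)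
  ... | no ¬sep = replaceable-joined p (All.tabulate (All.lookup d ∘ prune-⊆ L)) ¬sep ∷
                  prune-replaceable ps ds

  insert : StreamEdge n → List (StreamEdge n) → List (StreamEdge n)
  insert f []      = f ∷ []
  insert f (e ∷ L) with wt e ℚ.≤? wt f
  ... | yes _ = f ∷ e ∷ L
  ... | no  _ = e ∷ insert f L

  insert-All : ∀ {P : StreamEdge n → Set} {f L} → P f → All P L → All P (insert f L)
  insert-All {L = []} p []                = p ∷ []
  insert-All {f = f} {L = e ∷ L} p (q ∷ qs) with wt e ℚ.≤? wt f
  ... | yes _ = p ∷ q ∷ qs
  ... | no  _ = q ∷ insert-All p qs

  insert-⊇ : ∀ f L → f ∷ L ⊆ insert f L
  insert-⊇ f []      x∈ = x∈
  insert-⊇ f (e ∷ L) x∈ with wt e ℚ.≤? wt f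
  ... | yes _ = x∈
  insert-⊇ f (e ∷ L) (here eq)          | no _ = there (insert-⊇ f L (here eq))
  insert-⊇ f (e ∷ L) (there (here eq))  | no _ = here eq
  insert-⊇ f (e ∷ L) (there (there x∈)) | no _ = there (insert-⊇ f L (there x∈))

  insert-descending : ∀ {f L} → Descending L → Descending (insert f L)
  insert-descending {f} {[]}    []       = [] ∷ []
  insert-descending {f} {e ∷ L} (d ∷ ds) with wt e ℚ.≤? wt f
  ... | yes e≤f = (e≤f ∷ All.map (λ x≤e → ℚ.≤-trans x≤e e≤f) d) ∷ d ∷ ds
  ... | no  e≰f = insert-All (ℚ.<⇒≤ (ℚ.≰⇒> e≰f)) d ∷ insert-descending ds

  -- Each edge of an independent list retires one label for good.

  retired : List (StreamEdge n) → List (Fin n)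
  retired []      = []
  retired (e ∷ L) = label L (src e) ∷ retired L

  label∉retired : ∀ {L} → Independent L → ∀ x → All (label L x ≢_) (retired L)
  label∉retired {[]}    _           x = []
  label∉retired {e ∷ L} (sep , ind) x =
    merge-≢ _ _ (label L x) sep ∷ still
    where
    still : All (label (e ∷ L) x ≢_) (retired L)
    still with label L x ≟ label L (src e)
    ... | yes _ = label∉retired ind (tgt e)
    ... | no  _ = label∉retired ind x

  retired-unique : ∀ {L} → Independent L → Unique (retired L)
  retired-unique {[]}    _           = []
  retired-unique {e ∷ L} (sep , ind) = label∉retired ind (src e) ∷ retired-unique ind

  unique⇒length≤ : ∀ {xs : List (Fin n)} → Unique xs → length xs ℕ.≤ n
  unique⇒length≤ u = Fin.injective⇒≤ (lookup-injective u)

  length-retired : ∀ L → length (retired L) ≡ length L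
  length-retired []      = refl
  length-retired (e ∷ L) = cong suc (length-retired L)

  independent⇒length≤ : ∀ {L} → Independent L → length L ℕ.≤ n
  independent⇒length≤ {L} ind =
    subst (ℕ._≤ n) (length-retired L) (unique⇒length≤ (retired-unique ind))

xor-isCommutativeMonoid : IsCommutativeMonoid _≡_ _xor_ false
xor-isCommutativeMonoid = CommutativeRing.+-isCommutativeMonoid xor-∧-commutativeRing

module ⊕ = ListSum xor-isCommutativeMonoid

-- Cuts

Cut : ℕ → Set
Cut n = Fin n → Bool

xor-≡ : ∀ {a b} → a xor b ≡ false → a ≡ b
xor-≡ {true}  {true}  _ = refl
xor-≡ {false} {false} _ = refl

if-xor : ∀ a b c → (if a xor b then c else false) ≡ (if a then c else false) xor (if b then c else false)
if-xor true  true  c = sym (xor-same c)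
if-xor true  false true  = refl
if-xor true  false false = refl
if-xor false b     c = refl

⊕-if : ∀ {B : Set} (xs : List B) (p : B → Bool) b →
       ⊕.∑ xs (λ x → if p x then b else false) ≡ (if ⊕.∑ xs p then b else false)
⊕-if []       p b = refl
⊕-if (x ∷ xs) p b = trans (cong ((if p x then b else false) xor_) (⊕-if xs p b)) (sym (if-xor (p x) (⊕.∑ xs p) b))

module _ {n : ℕ} where

  crosses : Cut n → StreamEdge n → Bool
  crosses g e = g (src e) xor g (tgt e)

  addIf : Bool → Cut n → Cut n → Cut n
  addIf b c g x = g x xor (if b then c x else false)

  crosses-addIf : ∀ b c g e → crosses (addIf b c g) e ≡ crosses g e xor (if b then crosses c e else false)
  crosses-addIf true  c g e = ⊕.medial (g (src e)) (c (src e)) (g (tgt e)) (c (tgt e))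
  crosses-addIf false c g e = ⊕.medial (g (src e)) false (g (tgt e)) false

  record CutEdge : Set where
    constructor _,_
    field
      treeEdge : StreamEdge n
      side     : Cut n

  open CutEdge public

  -- The fundamental cuts of a forest, by Gaussian elimination: the two sides
  -- of the edge e of e ∷ L are told apart by the components of L, and the
  -- older cuts are corrected so as not to be crossed by e.

  newCut : StreamEdge n → List (StreamEdge n) → Cut n
  newCut e L x = does (label L x ≟ label L (src e))

  correct : StreamEdge n → Cut n → CutEdge → CutEdge
  correct e c (f , g) = f , addIf (crosses g e) c g

  cuts : List (StreamEdge n) → List CutEdge
  cuts []      = []
  cuts (e ∷ L) = (e , newCut e L) ∷ map (correct e (newCut e L)) (cuts L)

  cuts-edges : ∀ L → map treeEdge (cuts L) ≡ L
  cuts-edges []      = refl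
  cuts-edges (e ∷ L) = cong (e ∷_) (trans (sym (map-∘ (cuts L))) (cuts-edges L))

  CrossedOnce : List CutEdge → Set
  CrossedOnce D =
    All (λ d → crosses (side d) (treeEdge d) ≡ true) D ×
    AllPairs (λ d d′ → crosses (side d) (treeEdge d′) ≡ false ×
                       crosses (side d′) (treeEdge d) ≡ false) D

  newCut-respects : ∀ e L → All (λ f → crosses (newCut e L) f ≡ false) L
  newCut-respects e L = All.map
    (λ {f} eq → trans (cong (λ z → does (z ≟ label L (src e)) xor newCut e L (tgt f)) eq)
                      (xor-same (newCut e L (tgt f))))
    (label-respects L)

  newCut-crosses : ∀ e L → Separates L e → crosses (newCut e L) e ≡ true
  newCut-crosses e L sep with label L (src e) ≟ label L (src e) | label L (tgt e) ≟ label L (src e)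
  ... | yes _ | no  _  = refl
  ... | yes _ | yes eq = contradiction (sym eq) sep
  ... | no ¬r | _      = contradiction refl ¬r

  cuts-crossed-once : ∀ L → Independent L → CrossedOnce (cuts L)
  cuts-crossed-once []      _           = [] , []
  cuts-crossed-once (e ∷ L) (sep , ind) =
    newCut-crosses e L sep ∷ All.map⁺ (All.zipWith (λ {d} → own {d}) (c-flat , proj₁ IH)) ,
    All.map⁺ (All.map (λ {d} fl → fl , uncrossed d) c-flat) ∷
    AllPairs.map⁺ (pairs c-flat (proj₂ IH))
    where
    IH = cuts-crossed-once L ind
    c  = newCut e L

    c-flat : All (λ d → crosses c (treeEdge d) ≡ false) (cuts L)
    c-flat = All.map⁻ (subst (All _) (sym (cuts-edges L)) (newCut-respects e L))

    unaffected : ∀ d f → crosses c f ≡ false →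
                 crosses (side (correct e c d)) f ≡ crosses (side d) f
    unaffected (_ , g) f fl rewrite crosses-addIf (crosses g e) c g f | fl
      with crosses g e | crosses g f
    ... | true  | true  = refl
    ... | true  | false = refl
    ... | false | true  = refl
    ... | false | false = refl

    own : ∀ {d} → crosses c (treeEdge d) ≡ false × crosses (side d) (treeEdge d) ≡ true →
          crosses (side (correct e c d)) (treeEdge d) ≡ true
    own {d} (fl , eq) = trans (unaffected d (treeEdge d) fl) eq

    uncrossed : ∀ d → crosses (side (correct e c d)) e ≡ false
    uncrossed (_ , g) rewrite crosses-addIf (crosses g e) c g e | newCut-crosses e L sep
      with crosses g e
    ... | true  = refl
    ... | false = refl

    R : CutEdge → CutEdge → Set
    R d d′ = crosses (side d) (treeEdge d′) ≡ false × crosses (side d′) (treeEdge d) ≡ false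

    pairs : ∀ {D} → All (λ d → crosses c (treeEdge d) ≡ false) D → AllPairs R D →
            AllPairs (λ d d′ → R (correct e c d) (correct e c d′)) D
    pairs []        []       = []
    pairs {d ∷ _} (fl ∷ fls) (r ∷ rs) =
      All.zipWith (λ {d′} (fl′ , r₁ , r₂) →
        trans (unaffected d (treeEdge d′) fl′) r₁ , trans (unaffected d′ (treeEdge d) fl) r₂)
        (fls , r) ∷
      pairs fls rs

  module Delta {A : Set} {_∙_ : A → A → A} {ε : A} (M : IsCommutativeMonoid _≡_ _∙_ ε) where
    module S = ListSum M

    ∑-crossed : ∀ {D} → CrossedOnce D → ∀ (f : CutEdge → A) {d} → d ∈ D →
                S.∑ D (λ d′ → if crosses (side d′) (treeEdge d) then f d′ else ε) ≡ f d
    ∑-crossed {d ∷ D} (o ∷ os , r ∷ rs) f (here refl) rewrite o =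
      trans (cong (f d ∙_) (S.∑-if-none D _ f (All.map proj₂ r))) (IsCommutativeMonoid.identityʳ M (f d))
    ∑-crossed {d′ ∷ D} (o ∷ os , r ∷ rs) f {d} (there d∈D) rewrite proj₁ (All.lookup r d∈D) =
      trans (IsCommutativeMonoid.identityˡ M _) (∑-crossed (os , rs) f d∈D)

  -- The fundamental cycle relation: h changes along xy as it does along the
  -- tree path from x to y.

  fundamental-cycle : ∀ {D} → CrossedOnce D → Spanning (map treeEdge D) → ∀ (h : Cut n) x y →
    h x xor h y ≡ ⊕.∑ D (λ d → if side d x xor side d y then crosses h (treeEdge d) else false)
  fundamental-cycle {D} once sp h x y =
    trans (xor-≡ cancel) (sym (split x y))
    where
    ψ : Cut n
    ψ z = ⊕.∑ D (λ d → if side d z then crosses h (treeEdge d) else false)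

    split : ∀ x y → ⊕.∑ D (λ d → if side d x xor side d y then crosses h (treeEdge d) else false)
                    ≡ ψ x xor ψ y
    split x y = trans (⊕.∑-cong D (λ {d} _ → if-xor (side d x) (side d y) _)) (⊕.∑-∙ D _ _)

    flat : All (Respects (λ z → h z xor ψ z)) (map treeEdge D)
    flat = All.map⁺ (All.tabulate λ {d} d∈D →
      let u = src (treeEdge d); v = tgt (treeEdge d) in
      xor-≡ (trans (⊕.medial (h u) (ψ u) (h v) (ψ v))
            (trans (cong ((h u xor h v) xor_)
                     (trans (sym (split u v))
                       (Delta.∑-crossed xor-isCommutativeMonoid once
                         (λ d′ → crosses h (treeEdge d′)) d∈D)))
                   (xor-same (h u xor h v)))))

    cancel : (h x xor h y) xor (ψ x xor ψ y) ≡ false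
    cancel = trans (⊕.medial (h x) (h y) (ψ x) (ψ y)) (trans
      (cong (_xor (h y xor ψ y)) (spanning⇒constant sp (λ z → h z xor ψ z) flat x y))
      (xor-same (h y xor ψ y)))

  -- The tree with S and a second copy of each tree edge whose cut is crossed
  -- evenly by S: an even multigraph, on which an Euler tour exists.

  evenly : List (StreamEdge n) → CutEdge → Bool
  evenly S d = not (⊕.∑ S (crosses (side d)))

  evenCover : List CutEdge → List (StreamEdge n) → List (StreamEdge n)
  evenCover D S = map treeEdge D ++ S ++ map treeEdge (filterᵇ (evenly S) D)

  evenCover-even : ∀ {D} → CrossedOnce D → Spanning (map treeEdge D) → ∀ S h →
                   ⊕.∑ (evenCover D S) (crosses h) ≡ false
  evenCover-even {D} once sp S h = begin
    ⊕.∑ (evenCover D S) (crosses h)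
      ≡⟨ ⊕.∑-++ (map treeEdge D) _ (crosses h) ⟩
    ⊕.∑ (map treeEdge D) (crosses h) xor ⊕.∑ (S ++ map treeEdge (filterᵇ (evenly S) D)) (crosses h)
      ≡⟨ cong₂ _xor_ (⊕.∑-map treeEdge D (crosses h)) (⊕.∑-++ S _ (crosses h)) ⟩
    ⊕.∑ D δ xor (⊕.∑ S (crosses h) xor ⊕.∑ (map treeEdge (filterᵇ (evenly S) D)) (crosses h))
      ≡⟨ cong₂ (λ a b → ⊕.∑ D δ xor (a xor b)) S-part
           (trans (⊕.∑-map treeEdge (filterᵇ (evenly S) D) (crosses h)) (⊕.∑-filter (evenly S) D δ)) ⟩
    ⊕.∑ D δ xor (⊕.∑ D (λ d → if odd d then δ d else false) xor
                 ⊕.∑ D (λ d → if not (odd d) then δ d else false))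
      ≡⟨ cong (⊕.∑ D δ xor_) (⊕.∑-∙ D _ _) ⟨
    ⊕.∑ D δ xor ⊕.∑ D (λ d → (if odd d then δ d else false) xor (if not (odd d) then δ d else false))
      ≡⟨ cong (⊕.∑ D δ xor_) (⊕.∑-cong D (λ {d} _ → one-of (odd d) (δ d))) ⟩
    ⊕.∑ D δ xor ⊕.∑ D δ
      ≡⟨ xor-same (⊕.∑ D δ) ⟩
    false ∎
    where
    open ≡-Reasoning
    δ : CutEdge → Bool
    δ d = crosses h (treeEdge d)
    odd : CutEdge → Bool
    odd d = ⊕.∑ S (crosses (side d))

    one-of : ∀ a b → (if a then b else false) xor (if not a then b else false) ≡ b
    one-of true  true  = refl
    one-of true  false = refl
    one-of false _     = refl

    S-part : ⊕.∑ S (crosses h) ≡ ⊕.∑ D (λ d → if odd d then δ d else false)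
    S-part = begin
      ⊕.∑ S (crosses h)
        ≡⟨ ⊕.∑-cong S (λ {f} _ → fundamental-cycle once sp h (src f) (tgt f)) ⟩
      ⊕.∑ S (λ f → ⊕.∑ D (λ d → if crosses (side d) f then δ d else false))
        ≡⟨ ⊕.∑-swap S D _ ⟩
      ⊕.∑ D (λ d → ⊕.∑ S (λ f → if crosses (side d) f then δ d else false))
        ≡⟨ ⊕.∑-cong D (λ {d} _ → ⊕-if S (crosses (side d)) (δ d)) ⟩
      ⊕.∑ D (λ d → if odd d then δ d else false) ∎

  covered : List (StreamEdge n) → CutEdge → Bool
  covered F d = any (crosses (side d)) F

  uncoveredWeight : List CutEdge → List (StreamEdge n) → ℚ
  uncoveredWeight D F = ∑ D (λ d → if covered F d then 0ℚ else wt (treeEdge d))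

  module _ (D : List CutEdge) where

    private
      ω : CutEdge → ℚ
      ω d = wt (treeEdge d)

    Cost : (CutEdge → Bool) → List (StreamEdge n) → ℚ
    Cost p S = weightOf S + ∑ D (λ d → if not (p d xor ⊕.∑ S (crosses (side d))) then ω d else 0ℚ)

    average : Bool → Bool → ℚ → ℚ
    average c p w = if c then w else (if not p then w + w else 0ℚ)

    AverageCost : (CutEdge → Bool) → List (StreamEdge n) → ℚ
    AverageCost p F = weightOf F + ∑ D (λ d → average (covered F d) (p d) (ω d))

    -- Averaging over all S ⊆ F: the parity at a covered tree edge is odd for
    -- exactly half of the subsets.

    cheap-subset : ∀ F p → ∃[ S ] S ⊆ F × Cost p S + Cost p S ≤ AverageCost p F
    cheap-subset []      p = [] , id , ℚ.≤-reflexive base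
      where
      open ≡-Reasoning
      unit : ∀ b w → (if not (b xor false) then w else 0ℚ) + (if not (b xor false) then w else 0ℚ)
                     ≡ (if not b then w + w else 0ℚ)
      unit true  w = refl
      unit false w = refl
      base : Cost p [] + Cost p [] ≡ AverageCost p []
      base = begin
        (0ℚ + U) + (0ℚ + U) ≡⟨ cong₂ _+_ (ℚ.+-identityˡ U) (ℚ.+-identityˡ U) ⟩
        U + U               ≡⟨ ∑-∙ D _ _ ⟨
        _                   ≡⟨ ∑-cong D (λ {d} _ → unit (p d) (ω d)) ⟩
        V                   ≡⟨ ℚ.+-identityˡ V ⟨
        0ℚ + V              ∎
        where
        U = ∑ D (λ d → if not (p d xor false) then ω d else 0ℚ)
        V = ∑ D (λ d → average false (p d) (ω d))
    cheap-subset (f ∷ F) p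
      with S₁ , S₁⊆F , le₁ ← cheap-subset F p
      with S₂ , S₂⊆F , le₂ ← cheap-subset F (λ d → p d xor crosses (side d) f)
      = choose (Cost p S₁ + Cost p S₁ ℚ.≤? AverageCost p (f ∷ F))
      where
      p′ : CutEdge → Bool
      p′ d = p d xor crosses (side d) f

      cost-∷ : Cost p (f ∷ S₂) ≡ wt f + Cost p′ S₂
      cost-∷ = trans
        (cong (weightOf (f ∷ S₂) +_) (∑-cong D (λ {d} _ →
          cong (λ b → if not b then ω d else 0ℚ) (sym (xor-assoc (p d) (crosses (side d) f) _)))))
        (ℚ.+-assoc (wt f) (weightOf S₂) _)

      merge-average : ∀ a c q w → average c q w + average c (q xor a) w
                                  ≡ average (if a then true else c) q w + average (if a then true else c) q w
      merge-average true  true  q     w = refl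
      merge-average false true  q     w = refl
      merge-average true  false true  w = ℚ.+-identityˡ (w + w)
      merge-average true  false false w = ℚ.+-identityʳ (w + w)
      merge-average false false true  w = refl
      merge-average false false false w = refl

      balance : AverageCost p F + ((wt f + wt f) + AverageCost p′ F)
                ≡ AverageCost p (f ∷ F) + AverageCost p (f ∷ F)
      balance = begin
        (Φ + A) + ((wt f + wt f) + (Φ + B))
          ≡⟨ solve 4 (λ w φ a b → (φ :+ a) :+ ((w :+ w) :+ (φ :+ b))
                               := ((w :+ φ) :+ (w :+ φ)) :+ (a :+ b)) refl (wt f) Φ A B ⟩
        ((wt f + Φ) + (wt f + Φ)) + (A + B)
          ≡⟨ cong (((wt f + Φ) + (wt f + Φ)) +_) A+B ⟩
        ((wt f + Φ) + (wt f + Φ)) + (C + C)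
          ≡⟨ medial (wt f + Φ) (wt f + Φ) C C ⟩
        ((wt f + Φ) + C) + ((wt f + Φ) + C) ∎
        where
        open ≡-Reasoning
        open +-*-Solver
        Φ = weightOf F
        A = ∑ D (λ d → average (covered F d) (p d) (ω d))
        B = ∑ D (λ d → average (covered F d) (p′ d) (ω d))
        C = ∑ D (λ d → average (covered (f ∷ F) d) (p d) (ω d))
        or-if : ∀ a b → (if a then true else b) ≡ a ∨ b
        or-if true  b = refl
        or-if false b = refl
        A+B : A + B ≡ C + C
        A+B = trans (sym (∑-∙ D _ _)) (trans (∑-cong D (λ {d} _ →
          trans (merge-average (crosses (side d) f) (covered F d) (p d) (ω d))
                (cong (λ z → average z (p d) (ω d) + average z (p d) (ω d)) (or-if (crosses (side d) f) (covered F d)))))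
          (∑-∙ D _ _))

      choose : Dec _ → ∃[ S ] S ⊆ (f ∷ F) × Cost p S + Cost p S ≤ AverageCost p (f ∷ F)
      choose (yes le) = S₁ , there ∘ S₁⊆F , le
      choose (no ¬le) = f ∷ S₂ , (λ { (here eq) → here eq ; (there x∈) → there (S₂⊆F x∈) }) ,
        ℚ.≮⇒≥ λ gt → ℚ.<-irrefl (sym balance) (ℚ.<-≤-trans
          (ℚ.+-mono-< (ℚ.≰⇒> ¬le) gt)
          (ℚ.+-mono-≤ le₁ (begin
            Cost p (f ∷ S₂) + Cost p (f ∷ S₂)            ≡⟨ cong₂ _+_ cost-∷ cost-∷ ⟩
            (wt f + Cost p′ S₂) + (wt f + Cost p′ S₂)    ≡⟨ medial (wt f) _ (wt f) _ ⟩
            (wt f + wt f) + (Cost p′ S₂ + Cost p′ S₂)    ≤⟨ ℚ.+-monoʳ-≤ (wt f + wt f) le₂ ⟩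
            (wt f + wt f) + AverageCost p′ F             ∎)))
        where open ℚ.≤-Reasoning

    cheap-evenCover : ∀ F → ∃[ S ] S ⊆ F ×
      weightOf (evenCover D S) + weightOf (evenCover D S)
        ≤ (weightOf (map treeEdge D) + weightOf (map treeEdge D)) +
          ((weightOf (map treeEdge D) + uncoveredWeight D F) + weightOf F)
    cheap-evenCover F with S , S⊆F , le ← cheap-subset F (λ _ → false) = S , S⊆F , (begin
      W + W                            ≡⟨ cong₂ _+_ W-split W-split ⟩
      (τ + c) + (τ + c)                ≡⟨ medial τ c τ c ⟩
      (τ + τ) + (c + c)                ≤⟨ ℚ.+-monoʳ-≤ (τ + τ) le ⟩
      (τ + τ) + AverageCost _ F        ≡⟨ cong ((τ + τ) +_) average-split ⟩
      (τ + τ) + ((τ + uncoveredWeight D F) + weightOf F) ∎)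
      where
      open ℚ.≤-Reasoning
      W = weightOf (evenCover D S)
      τ = weightOf (map treeEdge D)
      c = Cost (λ _ → false) S

      W-split : W ≡ τ + c
      W-split = trans (∑-++ (map treeEdge D) _ wt) (cong (τ +_)
        (trans (∑-++ S _ wt) (cong (weightOf S +_)
          (trans (∑-map treeEdge (filterᵇ (evenly S) D) wt) (∑-filter (evenly S) D ω)))))

      term : ∀ b w → average b false w ≡ w + (if b then 0ℚ else w)
      term true  w = sym (ℚ.+-identityʳ w)
      term false w = refl

      average-split : AverageCost (λ _ → false) F ≡ (τ + uncoveredWeight D F) + weightOf F
      average-split = trans (ℚ.+-comm (weightOf F) _) (cong (_+ weightOf F)
        (trans (∑-cong D (λ {d} _ → term (covered F d) (ω d)))
        (trans (∑-∙ D _ _) (cong (_+ uncoveredWeight D F) (sym (∑-map treeEdge D wt))))))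

pluck : ∀ {A : Set} {P : A → Set} {xs} → Any P xs → ∃[ x ] ∃[ ys ] P x × xs ↭ x ∷ ys
pluck any with x , x∈xs , px ← find any with ys , zs , refl ← ∈-∃++ x∈xs =
  x , ys ++ zs , px , ↭.shift x ys zs

⊕-true : ∀ {A : Set} {p : A → Bool} xs → ⊕.∑ xs p ≡ true → Any (λ x → p x ≡ true) xs
⊕-true {p = p} (x ∷ xs) eq with p x in px
... | true  = here px
... | false = there (⊕-true xs eq)

module _ {n : ℕ} (G : WeightedGraph n) where

  private
    V = Fin n

  data Visits : ∀ {a b} → Walk G a b → V → Set where
    here  : ∀ {a b} {p : Walk G a b} → Visits p a
    there : ∀ {a b c x} {s : Adjacent G a b} {p : Walk G b c} → Visits p x → Visits (s ◅ p) x

  visits? : ∀ {a b} (p : Walk G a b) x → Dec (Visits p x)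
  visits? {a} ε       x = map′ (λ { refl → here }) (λ { here → refl }) (a ≟ x)
  visits? {a} (s ◅ p) x = map′
    [ (λ { refl → here }) , there ]′
    (λ { here → inj₁ refl ; (there v) → inj₂ v })
    (a ≟ x ⊎-dec visits? p x)

  walkWeight-◅◅ : ∀ {a b c} (p : Walk G a b) (q : Walk G b c) →
                  walkWeight G (p ◅◅ q) ≡ walkWeight G p + walkWeight G q
  walkWeight-◅◅ ε             q = sym (ℚ.+-identityˡ _)
  walkWeight-◅◅ ((w , _) ◅ p) q = trans (cong (w +_) (walkWeight-◅◅ p q)) (sym (ℚ.+-assoc w _ _))

  walkWeight-nonneg : ∀ {a b} (p : Walk G a b) → 0ℚ ≤ walkWeight G p
  walkWeight-nonneg ε              = ℚ.≤-refl
  walkWeight-nonneg ((w , eq) ◅ p) =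
    ℚ.+-mono-≤ (non-negative G _ _ w eq) (walkWeight-nonneg p)

  visits-target : ∀ {a b} (p : Walk G a b) → Visits p b
  visits-target ε       = here
  visits-target (s ◅ p) = there (visits-target p)

  visits-◅◅ˡ : ∀ {a b c x} {p : Walk G a b} (q : Walk G b c) → Visits p x → Visits (p ◅◅ q) x
  visits-◅◅ˡ q here      = here
  visits-◅◅ˡ q (there v) = there (visits-◅◅ˡ q v)

  visits-◅◅ʳ : ∀ {a b c x} (p : Walk G a b) {q : Walk G b c} → Visits q x → Visits (p ◅◅ q) x
  visits-◅◅ʳ ε       v = v
  visits-◅◅ʳ (s ◅ p) v = there (visits-◅◅ʳ p v)

  visits-◅◅⁻ : ∀ {a b c x} (p : Walk G a b) {q : Walk G b c} →
               Visits (p ◅◅ q) x → Visits p x ⊎ Visits q x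
  visits-◅◅⁻ ε       v         = inj₂ v
  visits-◅◅⁻ (s ◅ p) here      = inj₁ here
  visits-◅◅⁻ (s ◅ p) (there v) = Sum.map₁ there (visits-◅◅⁻ p v)

  split-at : ∀ {a b x} {p : Walk G a b} → Visits p x →
             Σ[ q ∈ Walk G a x ] Σ[ r ∈ Walk G x b ] q ◅◅ r ≡ p
  split-at {p = p} here = ε , p , refl
  split-at (there {s = s} v) with q , r , refl ← split-at v = s ◅ q , r , refl

  flip-step : ∀ {a b} → Adjacent G a b → Adjacent G b a
  flip-step {a} {b} (w , eq) = w , trans (symmetric G b a) eq

  reverse : ∀ {a b} → Walk G a b → Walk G b a
  reverse ε       = ε
  reverse (s ◅ p) = reverse p ◅◅ (flip-step s ◅ ε)

  walkWeight-reverse : ∀ {a b} (p : Walk G a b) → walkWeight G (reverse p) ≡ walkWeight G p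
  walkWeight-reverse ε             = refl
  walkWeight-reverse ((w , e) ◅ p) = begin
    walkWeight G (reverse p ◅◅ _)         ≡⟨ walkWeight-◅◅ (reverse p) _ ⟩
    walkWeight G (reverse p) + (w + 0ℚ)   ≡⟨ cong₂ _+_ (walkWeight-reverse p) (ℚ.+-identityʳ w) ⟩
    walkWeight G p + w                    ≡⟨ ℚ.+-comm _ w ⟩
    w + walkWeight G p                    ∎
    where open ≡-Reasoning

  visits-reverse : ∀ {a b x} {p : Walk G a b} → Visits p x → Visits (reverse p) x
  visits-reverse {p = p} here = visits-target (reverse p)
  visits-reverse {p = s ◅ p} (there v) = visits-◅◅ˡ _ (visits-reverse v)

  -- Euler tours

  record Trail : Set where
    constructor trail
    field
      {from to} : V
      path      : Walk G from to

  open Trail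

  Closed : Trail → Set
  Closed t = from t ≡ to t

  trailWeight : Trail → ℚ
  trailWeight t = walkWeight G (path t)

  Flat : Cut n → Trail → Set
  Flat g t = ∀ {x y} → Visits (path t) x → Visits (path t) y → g x ≡ g y

  Joined : List Trail → Set
  Joined Ts = ∀ (g : Cut n) → All (Flat g) Ts → Constant g

  infix 4 _≼_
  _≼_ : List Trail → List Trail → Set
  Ts ≼ Us = ∀ {t} → t ∈ Ts → Any (λ u → ∀ {x} → Visits (path t) x → Visits (path u) x) Us

  joined-≼ : ∀ {Ts Us} → Ts ≼ Us → Joined Ts → Joined Us
  joined-≼ {Ts} {Us} T≼U joined g flat = joined g (All.tabulate flat′)
    where
    flat′ : ∀ {t} → t ∈ Ts → Flat g t
    flat′ t∈T v w with u , u∈U , inc ← find (T≼U t∈T) = All.lookup flat u∈U (inc v) (inc w)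

  ≼-trans : ∀ {Ts Us Ws} → Ts ≼ Us → Us ≼ Ws → Ts ≼ Ws
  ≼-trans T≼U U≼W t∈T with u , u∈U , inc ← find (T≼U t∈T) =
    Any.map (λ inc′ {x} v → inc′ (inc v)) (U≼W u∈U)

  ≼-∷ : ∀ {t u Ts Us} → (∀ {x} → Visits (path t) x → Visits (path u) x) → Ts ≼ Us → t ∷ Ts ≼ u ∷ Us
  ≼-∷ inc T≼U (here refl) = here inc
  ≼-∷ inc T≼U (there t∈T) = there (T≼U t∈T)

  ends : Cut n → Trail → Bool
  ends g t = g (from t) xor g (to t)

  Even : List Trail → Set
  Even Ts = ∀ g → ⊕.∑ Ts (ends g) ≡ false

  at : V → Cut n
  at b x = does (x ≟ b)

  at-≢ : ∀ {x b} → x ≢ b → at b x ≡ false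
  at-≢ = dec-false (_ ≟ _)

  at-self : ∀ b → at b b ≡ true
  at-self b = dec-true (b ≟ b) refl

  incident : ∀ b t → ends (at b) t ≡ true →
    ∃[ c ] Σ[ q ∈ Walk G b c ] walkWeight G q ≡ trailWeight t ×
      (∀ g → ends g t ≡ g b xor g c) × (∀ {x} → Visits (path t) x → Visits q x)
  incident b t odd with from t ≟ b | to t ≟ b
  ... | yes refl | _        = to t , path t , refl , (λ _ → refl) , id
  ... | no _     | yes refl =
    from t , reverse (path t) , walkWeight-reverse (path t) ,
    (λ g → xor-comm (g (from t)) (g (to t))) ,
    visits-reverse
  incident b t () | no f≢b | no t≢b

  even-tail : ∀ {t Ts} → Closed t → Even (t ∷ Ts) → Even Ts
  even-tail {t} {Ts} cl even g with e ← even g rewrite sym cl | xor-same (g (from t)) = e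

  open-odd : ∀ {t Ts} → ¬ Closed t → Even (t ∷ Ts) → ⊕.∑ Ts (ends (at (to t))) ≡ true
  open-odd {t} {Ts} ¬cl even with e ← even (at (to t))
    rewrite at-≢ ¬cl | at-self (to t) with ⊕.∑ Ts (ends (at (to t)))
  ... | true = refl

  xor-telescope : ∀ a b c d → (a xor c) xor d ≡ (a xor b) xor ((b xor c) xor d)
  xor-telescope true  true  c     d = refl
  xor-telescope true  false true  d = sym (not-involutive d)
  xor-telescope true  false false d = refl
  xor-telescope false true  true  d = refl
  xor-telescope false true  false d = sym (not-involutive d)
  xor-telescope false false c     d = refl

  -- Trails are joined end to end until all of them are closed.

  close : ∀ k Ts → length Ts ℕ.≤ k → Even Ts →
    ∃[ Cs ] All Closed Cs × ∑ Cs trailWeight ≡ ∑ Ts trailWeight × Ts ≼ Cs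
  close _       []       _       _    = [] , [] , refl , λ ()
  close (suc k) (t ∷ Ts) (s≤s l) even with from t ≟ to t
  ... | yes cl with Cs , cls , w , le ← close k Ts l (even-tail {t} {Ts} cl even) =
    t ∷ Cs , cl ∷ cls , cong (trailWeight t +_) w , ≼-∷ {t} {t} id le
  ... | no ¬cl
    with u , Us , odd , perm ← pluck (⊕-true Ts (open-odd {t} {Ts} ¬cl even))
    with c , q , wq , eq , vq ← incident (to t) u odd
    with Cs , cls , w , le ← close k (trail (path t ◅◅ q) ∷ Us)
           (subst (ℕ._≤ k) (↭.↭-length perm) l)
           (λ g → trans (xor-telescope (g (from t)) (g (to t)) (g c) _) (trans
             (cong ((g (from t) xor g (to t)) xor_)
               (sym (trans (⊕.∑-↭ perm (ends g)) (cong (_xor ⊕.∑ Us (ends g)) (eq g)))))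
             (even g)))
    = Cs , cls , trans w weights , ≼-trans grow le
    where
    open ≡-Reasoning
    weights : walkWeight G (path t ◅◅ q) + ∑ Us trailWeight ≡ trailWeight t + ∑ Ts trailWeight
    weights = begin
      walkWeight G (path t ◅◅ q) + ∑ Us trailWeight
        ≡⟨ cong (_+ ∑ Us trailWeight) (walkWeight-◅◅ (path t) q) ⟩
      (trailWeight t + walkWeight G q) + ∑ Us trailWeight
        ≡⟨ ℚ.+-assoc (trailWeight t) _ _ ⟩
      trailWeight t + (walkWeight G q + ∑ Us trailWeight)
        ≡⟨ cong (λ z → trailWeight t + (z + ∑ Us trailWeight)) wq ⟩
      trailWeight t + ∑ (u ∷ Us) trailWeight
        ≡⟨ cong (trailWeight t +_) (∑-↭ perm trailWeight) ⟨
      trailWeight t + ∑ Ts trailWeight ∎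

    grow : t ∷ Ts ≼ trail (path t ◅◅ q) ∷ Us
    grow (here refl) = here (visits-◅◅ˡ q)
    grow (there t∈) with ↭.∈-resp-↭ perm t∈
    ... | here refl = here (visits-◅◅ʳ (path t) ∘ vq)
    ... | there t∈U = there (lose t∈U id)

  splice-≼ : ∀ {a b c Ts Us} (W₁ : Walk G a b) {W₂ : Walk G b a} (C₁ : Walk G c b) {C₂ : Walk G b c} →
             Ts ↭ trail (C₁ ◅◅ C₂) ∷ Us →
             trail (W₁ ◅◅ W₂) ∷ Ts ≼ trail (W₁ ◅◅ ((C₂ ◅◅ C₁) ◅◅ W₂)) ∷ Us
  splice-≼ W₁ C₁ {C₂} perm (here refl) =
    here λ v → [ visits-◅◅ˡ _ , visits-◅◅ʳ W₁ ∘ visits-◅◅ʳ (C₂ ◅◅ C₁) ]′ (visits-◅◅⁻ W₁ v)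
  splice-≼ W₁ {W₂} C₁ {C₂} perm (there t∈) with ↭.∈-resp-↭ perm t∈
  ... | there t∈U = there (lose t∈U id)
  ... | here refl = here λ v → visits-◅◅ʳ W₁ (visits-◅◅ˡ W₂
    ([ visits-◅◅ʳ C₂ , visits-◅◅ˡ C₁ ]′ (visits-◅◅⁻ C₁ v)))

  splice-weight : ∀ {a b c} (W₁ : Walk G a b) {W₂ : Walk G b a} (C₁ : Walk G c b) {C₂ : Walk G b c} →
                  walkWeight G (W₁ ◅◅ ((C₂ ◅◅ C₁) ◅◅ W₂)) ≡ walkWeight G (W₁ ◅◅ W₂) + walkWeight G (C₁ ◅◅ C₂)
  splice-weight W₁ {W₂} C₁ {C₂} = begin
    walkWeight G (W₁ ◅◅ ((C₂ ◅◅ C₁) ◅◅ W₂))  ≡⟨ walkWeight-◅◅ W₁ _ ⟩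
    w₁ + walkWeight G ((C₂ ◅◅ C₁) ◅◅ W₂)     ≡⟨ cong (w₁ +_) (walkWeight-◅◅ (C₂ ◅◅ C₁) W₂) ⟩
    w₁ + (walkWeight G (C₂ ◅◅ C₁) + w₂)      ≡⟨ cong (λ z → w₁ + (z + w₂)) (walkWeight-◅◅ C₂ C₁) ⟩
    w₁ + ((c₂ + c₁) + w₂)                    ≡⟨ cong (w₁ +_) (ℚ.+-comm (c₂ + c₁) w₂) ⟩
    w₁ + (w₂ + (c₂ + c₁))                    ≡⟨ ℚ.+-assoc w₁ w₂ _ ⟨
    (w₁ + w₂) + (c₂ + c₁)                    ≡⟨ cong₂ _+_ (walkWeight-◅◅ W₁ W₂) (trans (walkWeight-◅◅ C₁ C₂) (ℚ.+-comm c₁ c₂)) ⟨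
    walkWeight G (W₁ ◅◅ W₂) + walkWeight G (C₁ ◅◅ C₂) ∎
    where
    open ≡-Reasoning
    w₁ = walkWeight G W₁
    w₂ = walkWeight G W₂
    c₁ = walkWeight G C₁
    c₂ = walkWeight G C₂

  -- Closed walks are spliced into each other at common vertices.

  splice : ∀ k {a} (W : Walk G a a) Cs → length Cs ℕ.≤ k → All Closed Cs → Joined (trail W ∷ Cs) →
    Σ[ W′ ∈ Walk G a a ] (∀ x → Visits W′ x) × walkWeight G W′ ≤ walkWeight G W + ∑ Cs trailWeight
  splice k {a} W Cs l cls joined
    with any? (λ t → Fin.any? (λ x → visits? W x ×-dec visits? (path t) x)) Cs
  ... | no none =
    W , (λ x → reached (joined (λ z → does (visits? W z)) (flatW ∷ All.tabulate flatC) x a)) ,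
    ℚ.≤-trans (ℚ.≤-reflexive (sym (ℚ.+-identityʳ _)))
      (ℚ.+-monoʳ-≤ (walkWeight G W) (∑-nonneg Cs (λ {t} _ → walkWeight-nonneg (path t))))
    where
    flatW : Flat (λ z → does (visits? W z)) (trail W)
    flatW {x} {y} v w = trans (dec-true (visits? W x) v) (sym (dec-true (visits? W y) w))
    flatC : ∀ {t} → t ∈ Cs → Flat (λ z → does (visits? W z)) t
    flatC t∈ {x} {y} v w = trans
      (dec-false (visits? W x) (λ u → none (lose t∈ (x , u , v))))
      (sym (dec-false (visits? W y) (λ u → none (lose t∈ (y , u , w)))))
    reached : ∀ {x} → does (visits? W x) ≡ does (visits? W a) → Visits W x
    reached {x} eq with visits? W x | trans eq (dec-true (visits? W a) here)
    ... | yes v | _ = v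
  splice zero {a} W (_ ∷ _) () cls joined | yes _
  splice (suc k) {a} W Cs l cls joined | yes some
    with trail {c} C , Us , (x , vW , vC) , perm ← pluck some
    with refl ∷ clU ← ↭.All-resp-↭ perm cls
    with W₁ , W₂ , refl ← split-at vW
    with C₁ , C₂ , refl ← split-at vC
    with W′ , all , le ← splice k (W₁ ◅◅ ((C₂ ◅◅ C₁) ◅◅ W₂)) Us
           (ℕ.≤-pred (subst (ℕ._≤ suc k) (↭.↭-length perm) l)) clU (joined-≼ (splice-≼ W₁ C₁ perm) joined)
    = W′ , all , ℚ.≤-trans le (ℚ.≤-reflexive weights)
    where
    weights : walkWeight G (W₁ ◅◅ ((C₂ ◅◅ C₁) ◅◅ W₂)) + ∑ Us trailWeight
              ≡ walkWeight G (W₁ ◅◅ W₂) + ∑ Cs trailWeight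
    weights = begin
      walkWeight G (W₁ ◅◅ ((C₂ ◅◅ C₁) ◅◅ W₂)) + ∑ Us trailWeight
        ≡⟨ cong (_+ ∑ Us trailWeight) (splice-weight W₁ C₁) ⟩
      (walkWeight G (W₁ ◅◅ W₂) + walkWeight G (C₁ ◅◅ C₂)) + ∑ Us trailWeight
        ≡⟨ ℚ.+-assoc (walkWeight G (W₁ ◅◅ W₂)) _ _ ⟩
      walkWeight G (W₁ ◅◅ W₂) + (walkWeight G (C₁ ◅◅ C₂) + ∑ Us trailWeight)
        ≡⟨ cong (walkWeight G (W₁ ◅◅ W₂) +_) (∑-↭ perm trailWeight) ⟨
      walkWeight G (W₁ ◅◅ W₂) + ∑ Cs trailWeight ∎
      where open ≡-Reasoning

  InGraph : StreamEdge n → Set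
  InGraph e = weight G (src e) (tgt e) ≡ just (wt e)

  edgeTrail : ∀ {e} → InGraph e → Trail
  edgeTrail {e} ok = trail ((wt e , ok) ◅ ε)

  edgeTrails : ∀ {L} → All InGraph L → List Trail
  edgeTrails = All.reduce edgeTrail

  edgeTrails-ends : ∀ {L} (oks : All InGraph L) g → ⊕.∑ (edgeTrails oks) (ends g) ≡ ⊕.∑ L (crosses g)
  edgeTrails-ends []         g = refl
  edgeTrails-ends {e ∷ _} (ok ∷ oks) g = cong (crosses g e xor_) (edgeTrails-ends oks g)

  edgeTrails-weight : ∀ {L} (oks : All InGraph L) → ∑ (edgeTrails oks) trailWeight ≡ weightOf L
  edgeTrails-weight []         = refl
  edgeTrails-weight {e ∷ _} (ok ∷ oks) = cong₂ _+_ (ℚ.+-identityʳ (wt e)) (edgeTrails-weight oks)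

  edgeTrails-respects : ∀ {L} (oks : All InGraph L) g → All (Flat g) (edgeTrails oks) → All (Respects g) L
  edgeTrails-respects []         g []       = []
  edgeTrails-respects (ok ∷ oks) g (f ∷ fs) = f here (there here) ∷ edgeTrails-respects oks g fs

  euler : ∀ L → All InGraph L → (∀ g → ⊕.∑ L (crosses g) ≡ false) → Spanning L → ∀ r →
    Σ[ W ∈ Walk G r r ] (∀ x → Visits W x) × walkWeight G W ≤ weightOf L
  euler L oks even sp r
    with Cs , cls , w , le ← close _ (edgeTrails oks) ℕ.≤-refl (λ g → trans (edgeTrails-ends oks g) (even g))
    with W , all , wW ← splice _ ε Cs ℕ.≤-refl cls
           (joined-≼ {edgeTrails oks} (λ t∈ → there (le t∈))
             (λ g flat → spanning⇒constant sp g (edgeTrails-respects oks g flat)))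
    = W , all , ℚ.≤-trans wW (ℚ.≤-reflexive (trans (ℚ.+-identityˡ _) (trans w (edgeTrails-weight oks))))

-- Tours

cyclicSuc-inject₁ : ∀ {m} (i : Fin m) → cyclicSuc (inject₁ i) ≡ Fin.suc i
cyclicSuc-inject₁ {m} i = Fin.toℕ-injective (trans (Fin.toℕ-fromℕ< _) (trans
  (ℕ.m<n⇒m%n≡m (s≤s (subst (ℕ._< m) (sym (Fin.toℕ-inject₁ i)) (Fin.toℕ<n i))))
  (cong suc (Fin.toℕ-inject₁ i))))

cyclicSuc-fromℕ : ∀ m → cyclicSuc (fromℕ m) ≡ Fin.zero
cyclicSuc-fromℕ m = Fin.toℕ-injective (trans (Fin.toℕ-fromℕ< _) (trans
  (cong (λ k → suc k ℕ.% suc m) (Fin.toℕ-fromℕ m)) (ℕ.n%n≡0 (suc m))))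

module _ {V : Set} (d : V → V → ℚ) where

  pathSum : ∀ {m} → (Fin (suc m) → V) → ℚ
  pathSum f = sum (λ i → d (f (inject₁ i)) (f (Fin.suc i)))

  cycleSum : ∀ {m} (f : Fin (suc m) → V) →
    sum (λ i → d (f i) (f (cyclicSuc i))) ≡ pathSum f + d (f (fromℕ m)) (f Fin.zero)
  cycleSum {m} f = trans (sum-init-last (λ i → d (f i) (f (cyclicSuc i))))
    (cong₂ _+_ (sum-cong-≗ (λ i → cong (d (f (inject₁ i)) ∘ f) (cyclicSuc-inject₁ i)))
               (cong (d (f (fromℕ m)) ∘ f) (cyclicSuc-fromℕ m)))

  chain : V → List V → V → ℚ
  chain a []       b = d a b
  chain a (x ∷ xs) b = d a x + chain x xs b

  chain-pathSum : ∀ a xs b →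
    chain a xs b ≡ pathSum (lookup (a ∷ xs)) + d (lookup (a ∷ xs) (fromℕ (length xs))) b
  chain-pathSum a []       b = sym (ℚ.+-identityˡ (d a b))
  chain-pathSum a (x ∷ xs) b =
    trans (cong (d a x +_) (chain-pathSum x xs b)) (sym (ℚ.+-assoc (d a x) _ _))

module _ {n : ℕ} (d : Fin n → Fin n → ℚ) where

  tour-through : ∀ {m} (ρ : Permutation (suc m) n) → suc m ≡ n →
    ∃[ π ] tourWeight d π ≡ sum (λ i → d (ρ ⟨$⟩ʳ i) (ρ ⟨$⟩ʳ cyclicSuc i))
  tour-through ρ refl = ρ , refl

  listing : ∀ xs → Unique xs → (∀ x → x ∈ xs) → Permutation (length xs) n
  listing xs unique complete = permutation (lookup xs) (index ∘ complete)
    (λ x → sym (lookup-index (complete x)))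
    (λ i → lookup-injective unique (sym (lookup-index (complete (lookup xs i)))))

  listing-tour : ∀ a xs → Unique (a ∷ xs) → (∀ x → x ∈ a ∷ xs) →
    ∃[ π ] tourWeight d π ≡ chain d a xs a
  listing-tour a xs unique complete
    with ρ ← listing (a ∷ xs) unique complete in ρ≡
    with π , eq ← tour-through ρ (↔⇒≡ ρ) = π , trans eq (subst
      (λ ρ → sum (λ i → d (ρ ⟨$⟩ʳ i) (ρ ⟨$⟩ʳ cyclicSuc i)) ≡ chain d a xs a) ρ≡
      (trans (cycleSum d (lookup (a ∷ xs))) (sym (chain-pathSum d a xs a))))

module _ {n : ℕ} (G : WeightedGraph n) (d : Fin n → Fin n → ℚ) (metric : IsShortestPathMetric G d) where

  open DecMembership (_≟_ {n}) using (_∈?_)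

  snoc-weight : ∀ {v u u′ b} (q : Walk G v u) (s : Adjacent G u u′) (p : Walk G u′ b) →
    walkWeight G (q ◅◅ (s ◅ ε)) + walkWeight G p ≡ walkWeight G q + walkWeight G (s ◅ p)
  snoc-weight q s p = begin
    walkWeight G (q ◅◅ (s ◅ ε)) + walkWeight G p
      ≡⟨ cong (_+ walkWeight G p) (walkWeight-◅◅ G q (s ◅ ε)) ⟩
    (walkWeight G q + (proj₁ s + 0ℚ)) + walkWeight G p
      ≡⟨ cong (λ z → (walkWeight G q + z) + walkWeight G p) (ℚ.+-identityʳ (proj₁ s)) ⟩
    (walkWeight G q + proj₁ s) + walkWeight G p
      ≡⟨ ℚ.+-assoc (walkWeight G q) (proj₁ s) (walkWeight G p) ⟩
    walkWeight G q + walkWeight G (s ◅ p) ∎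
    where open ≡-Reasoning

  -- q leads from the last vertex v that was kept to the current vertex u.

  shortcut : ∀ {v u b} (q : Walk G v u) (p : Walk G u b) seen → u ∈ seen →
    ∃[ xs ] Unique xs × All (_∉ seen) xs × (∀ {x} → Visits G p x → x ∈ seen ⊎ x ∈ xs) ×
            chain d v xs b ≤ walkWeight G q + walkWeight G p
  shortcut q ε seen u∈ =
    [] , [] , [] , (λ { here → inj₁ u∈ }) ,
    ℚ.≤-trans (proj₂ (metric _ _) q) (ℚ.≤-reflexive (sym (ℚ.+-identityʳ _)))
  shortcut {v} q (_◅_ {j = u′} s p) seen u∈ with u′ ∈? seen
  ... | yes u′∈ with xs , unique , fresh , visited , le ← shortcut (q ◅◅ (s ◅ ε)) p seen u′∈ =
    xs , unique , fresh , (λ { here → inj₁ u∈ ; (there w) → visited w }) ,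
    ℚ.≤-trans le (ℚ.≤-reflexive (snoc-weight q s p))
  ... | no u′∉ with xs , unique , fresh , visited , le ← shortcut ε p (u′ ∷ seen) (here refl) =
    u′ ∷ xs , All.map (λ { x∉ refl → x∉ (here refl) }) fresh ∷ unique ,
    u′∉ ∷ All.map (λ x∉ x∈ → x∉ (there x∈)) fresh ,
    (λ { here → inj₁ u∈ ; (there w) → relocate (visited w) }) ,
    (begin
      d v u′ + chain d u′ xs _                          ≤⟨ ℚ.+-mono-≤ (proj₂ (metric v u′) (q ◅◅ (s ◅ ε))) le ⟩
      walkWeight G (q ◅◅ (s ◅ ε)) + (0ℚ + walkWeight G p) 
        ≡⟨ cong (walkWeight G (q ◅◅ (s ◅ ε)) +_) (ℚ.+-identityˡ (walkWeight G p)) ⟩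
      walkWeight G (q ◅◅ (s ◅ ε)) + walkWeight G p      ≡⟨ snoc-weight q s p ⟩
      walkWeight G q + walkWeight G (s ◅ p)             ∎)
    where
    open ℚ.≤-Reasoning
    relocate : ∀ {x} → x ∈ u′ ∷ seen ⊎ x ∈ xs → x ∈ seen ⊎ x ∈ u′ ∷ xs
    relocate (inj₁ (here eq)) = inj₂ (here eq)
    relocate (inj₁ (there x∈)) = inj₁ x∈
    relocate (inj₂ x∈) = inj₂ (there x∈)

  walk⇒tour : ∀ {r} (W : Walk G r r) → (∀ x → Visits G W x) →
              ∃[ π ] tourWeight d π ≤ walkWeight G W
  walk⇒tour {r} W all
    with xs , unique , fresh , visited , le ← shortcut ε W (r ∷ []) (here refl)
    with π , eq ← listing-tour d r xs (All.map (λ { x∉ refl → x∉ (here refl) }) fresh ∷ unique)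
                    (λ x → [ (λ { (here eq) → here eq }) , there ]′ (visited (all x)))
    = π , ℚ.≤-trans (ℚ.≤-reflexive eq) (ℚ.≤-trans le (ℚ.≤-reflexive (ℚ.+-identityˡ (walkWeight G W))))

  path-walk : ∀ {m} (f : Fin (suc m) → Fin n) →
    Σ[ W ∈ Walk G (f Fin.zero) (f (fromℕ m)) ] (∀ i → Visits G W (f i)) × walkWeight G W ≡ pathSum d f
  path-walk {zero}  f = ε , (λ { Fin.zero → here }) , refl
  path-walk {suc m} f
    with (p , wp) , _ ← metric (f Fin.zero) (f (Fin.suc Fin.zero))
    with W , all , wW ← path-walk (f ∘ Fin.suc)
    = p ◅◅ W , (λ { Fin.zero → visits-◅◅ˡ G W here ; (Fin.suc i) → visits-◅◅ʳ G p (all i) }) ,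
      trans (walkWeight-◅◅ G p W) (cong₂ _+_ wp wW)

module _ {m : ℕ} (G : WeightedGraph (suc m)) (d : Fin (suc m) → Fin (suc m) → ℚ)
         (metric : IsShortestPathMetric G d) where

  tour⇒walk : ∀ π → ∃[ r ] Σ[ W ∈ Walk G r r ] (∀ x → Visits G W x) × walkWeight G W ≡ tourWeight d π
  tour⇒walk π
    with W , all , wW ← path-walk G d metric (π ⟨$⟩ʳ_)
    with (p , wp) , _ ← metric (π ⟨$⟩ʳ fromℕ m) (π ⟨$⟩ʳ Fin.zero)
    = π ⟨$⟩ʳ Fin.zero , W ◅◅ p ,
      (λ x → subst (Visits G (W ◅◅ p)) (inverseʳ π) (visits-◅◅ˡ G p (all (π ⟨$⟩ˡ x)))) ,
      trans (walkWeight-◅◅ G W p) (trans (cong₂ _+_ wW wp) (sym (cycleSum d (π ⟨$⟩ʳ_))))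

if-nonneg : ∀ b {q} → 0ℚ ≤ q → 0ℚ ≤ (if b then q else 0ℚ)
if-nonneg true  p = p
if-nonneg false p = ℚ.≤-refl

if-nonneg′ : ∀ b {q} → 0ℚ ≤ q → 0ℚ ≤ (if b then 0ℚ else q)
if-nonneg′ true  p = ℚ.≤-refl
if-nonneg′ false p = p

p≤p+q : ∀ p {q} → 0ℚ ≤ q → p ≤ p + q
p≤p+q p 0≤q = ℚ.≤-trans (ℚ.≤-reflexive (sym (ℚ.+-identityʳ p))) (ℚ.+-monoʳ-≤ p 0≤q)

-- Greedy covering of the tree

-- ratio = 7/5 approximates √2, which minimises the approximation factor
-- 2 − 1/2 (1 − 1/c) + (c − 1)/4 reached by accepting edges at ratio c.

ratio : ℚ
ratio = ℤ.+ 7 / 5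

module _ {n : ℕ} where

  newWeight : List (CutEdge {n}) → List (StreamEdge n) → StreamEdge n → ℚ
  newWeight D F f = ∑ D λ d →
    if crosses (side d) f then (if covered F d then 0ℚ else wt (treeEdge d)) else 0ℚ

  cover : List CutEdge → List (StreamEdge n) → StreamEdge n → List (StreamEdge n)
  cover D F f with ratio * wt f ℚ.<? newWeight D F f
  ... | yes _ = f ∷ F
  ... | no  _ = F

  module _ (D : List CutEdge) (D≥0 : ∀ {d} → d ∈ D → 0ℚ ≤ wt (treeEdge {n} d)) where

    newWeight-∷ : ∀ F f e → newWeight D (f ∷ F) e ≤ newWeight D F e
    newWeight-∷ F f e = ∑-mono D λ {d} d∈ →
      term (crosses (side d) e) (crosses (side d) f) (covered F d) (D≥0 d∈)
      where
      term : ∀ a b c {w} → 0ℚ ≤ w → (if a then (if b ∨ c then 0ℚ else w) else 0ℚ)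
                                    ≤ (if a then (if c then 0ℚ else w) else 0ℚ)
      term true  true  true  0≤w = ℚ.≤-refl
      term true  true  false 0≤w = 0≤w
      term true  false true  0≤w = ℚ.≤-refl
      term true  false false 0≤w = ℚ.≤-refl
      term false b     c     0≤w = ℚ.≤-refl

    newWeight-self : ∀ F f → newWeight D (f ∷ F) f ≡ 0ℚ
    newWeight-self F f = trans (∑-cong D (λ {d} _ → term (crosses (side d) f) (covered F d) _)) (∑-ε D)
      where
      term : ∀ a c w → (if a then (if a ∨ c then 0ℚ else w) else 0ℚ) ≡ 0ℚ
      term true  c w = refl
      term false c w = refl

    uncovered-split : ∀ F f → newWeight D F f + uncoveredWeight D (f ∷ F) ≡ uncoveredWeight D F
    uncovered-split F f = trans (sym (∑-∙ D _ _))
      (∑-cong D (λ {d} _ → term (crosses (side d) f) (covered F d) _))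
      where
      term : ∀ a c w → (if a then (if c then 0ℚ else w) else 0ℚ) + (if a ∨ c then 0ℚ else w)
                       ≡ (if c then 0ℚ else w)
      term true  c w = ℚ.+-identityʳ _
      term false c w = ℚ.+-identityˡ _

    Exhausted : List (StreamEdge n) → StreamEdge n → Set
    Exhausted F e = newWeight D F e ≤ ratio * wt e

    Paid : List (StreamEdge n) → Set
    Paid F = ratio * weightOf F + uncoveredWeight D F ≤ weightOf (map treeEdge D)

    paid-[] : Paid []
    paid-[] = ℚ.≤-reflexive (begin
      ratio * 0ℚ + ∑ D (wt ∘ treeEdge)  ≡⟨ cong (_+ ∑ D (wt ∘ treeEdge)) (ℚ.*-zeroʳ ratio) ⟩
      0ℚ + ∑ D (wt ∘ treeEdge)          ≡⟨ ℚ.+-identityˡ _ ⟩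
      ∑ D (wt ∘ treeEdge)               ≡⟨ ∑-map treeEdge D wt ⟨
      weightOf (map treeEdge D)         ∎)
      where open ≡-Reasoning

    cover-paid : ∀ {F} f → Paid F → Paid (cover D F f)
    cover-paid {F} f paid with ratio * wt f ℚ.<? newWeight D F f
    ... | no  _  = paid
    ... | yes lt = begin
      ratio * (wt f + weightOf F) + U′          ≡⟨ cong (_+ U′) (ℚ.*-distribˡ-+ ratio (wt f) (weightOf F)) ⟩
      (ratio * wt f + ratio * weightOf F) + U′  ≤⟨ ℚ.+-monoˡ-≤ U′ (ℚ.+-monoˡ-≤ (ratio * weightOf F) (ℚ.<⇒≤ lt)) ⟩
      (N + ratio * weightOf F) + U′             ≡⟨ cong (_+ U′) (ℚ.+-comm N _) ⟩
      (ratio * weightOf F + N) + U′             ≡⟨ ℚ.+-assoc (ratio * weightOf F) N U′ ⟩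
      ratio * weightOf F + (N + U′)             ≡⟨ cong (ratio * weightOf F +_) (uncovered-split F f) ⟩
      ratio * weightOf F + uncoveredWeight D F  ≤⟨ paid ⟩
      weightOf (map treeEdge D)                 ∎
      where
      open ℚ.≤-Reasoning
      N  = newWeight D F f
      U′ = uncoveredWeight D (f ∷ F)

    cover-exhausted : ∀ {F} f {e} → Exhausted F e → Exhausted (cover D F f) e
    cover-exhausted {F} f {e} ex with ratio * wt f ℚ.<? newWeight D F f
    ... | no  _ = ex
    ... | yes _ = ℚ.≤-trans (newWeight-∷ F f e) ex

    cover-exhausted-self : ∀ {F} f → 0ℚ ≤ wt f → Exhausted (cover D F f) f
    cover-exhausted-self {F} f 0≤f with ratio * wt f ℚ.<? newWeight D F f
    ... | no  ≮ = ℚ.≮⇒≥ ≮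
    ... | yes _ = begin
      newWeight D (f ∷ F) f  ≡⟨ newWeight-self F f ⟩
      0ℚ                     ≡⟨ ℚ.*-zeroʳ ratio ⟨
      ratio * 0ℚ             ≤⟨ ℚ.*-monoˡ-≤-nonNeg ratio 0≤f ⟩
      ratio * wt f           ∎
      where open ℚ.≤-Reasoning

  uncoveredCount : List CutEdge → List (StreamEdge n) → ℕ
  uncoveredCount []      F = 0
  uncoveredCount (d ∷ D) F = (if covered F d then 0 else 1) ℕ.+ uncoveredCount D F

  uncoveredCount-[] : ∀ D → uncoveredCount D [] ≡ length D
  uncoveredCount-[] []      = refl
  uncoveredCount-[] (d ∷ D) = cong suc (uncoveredCount-[] D)

  uncoveredCount-∷ : ∀ D F f → uncoveredCount D (f ∷ F) ℕ.≤ uncoveredCount D F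
  uncoveredCount-∷ []      F f = z≤n
  uncoveredCount-∷ (d ∷ D) F f with crosses (side d) f | covered F d
  ... | true  | true  = uncoveredCount-∷ D F f
  ... | true  | false = ℕ.m≤n⇒m≤1+n (uncoveredCount-∷ D F f)
  ... | false | true  = uncoveredCount-∷ D F f
  ... | false | false = s≤s (uncoveredCount-∷ D F f)

  uncoveredCount-< : ∀ D F f → newWeight D F f ≡ 0ℚ ⊎ uncoveredCount D (f ∷ F) ℕ.< uncoveredCount D F
  uncoveredCount-< []      F f = inj₁ refl
  uncoveredCount-< (d ∷ D) F f
    with crosses (side d) f | covered F d | uncoveredCount-< D F f
  ... | true  | true  | inj₁ eq = inj₁ (trans (ℚ.+-identityˡ _) eq)
  ... | true  | true  | inj₂ lt = inj₂ lt
  ... | true  | false | _       = inj₂ (s≤s (uncoveredCount-∷ D F f))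
  ... | false | true  | inj₁ eq = inj₁ (trans (ℚ.+-identityˡ _) eq)
  ... | false | true  | inj₂ lt = inj₂ lt
  ... | false | false | inj₁ eq = inj₁ (trans (ℚ.+-identityˡ _) eq)
  ... | false | false | inj₂ lt = inj₂ (s≤s lt)

  cover-length : ∀ {D F} f → 0ℚ ≤ wt f → length F ℕ.+ uncoveredCount D F ℕ.≤ length D →
                 length (cover D F f) ℕ.+ uncoveredCount D (cover D F f) ℕ.≤ length D
  cover-length {D} {F} f 0≤f le with ratio * wt f ℚ.<? newWeight D F f | uncoveredCount-< D F f
  ... | no  _  | _       = le
  ... | yes lt | inj₁ eq = ⊥-elim (ℚ.<-irrefl {ratio * wt f} {ratio * wt f} refl (begin-strict
    ratio * wt f      <⟨ lt ⟩
    newWeight D F f   ≡⟨ eq ⟩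
    0ℚ                ≡⟨ ℚ.*-zeroʳ ratio ⟨
    ratio * 0ℚ        ≤⟨ ℚ.*-monoˡ-≤-nonNeg ratio 0≤f ⟩
    ratio * wt f      ∎))
    where open ℚ.≤-Reasoning
  ... | yes _  | inj₂ lt = ℕ.≤-trans
    (ℕ.≤-reflexive (sym (ℕ.+-suc (length F) _))) (ℕ.≤-trans (ℕ.+-monoʳ-≤ (length F) lt) le)

  -- Double counting

  tree-lightest : ∀ {D : List (CutEdge {n})} {B} → CrossedOnce D → (∀ {d} → d ∈ D → 0ℚ ≤ wt (treeEdge d)) →
                  B ⊆ map treeEdge D → Spanning B → weightOf (map treeEdge D) ≤ weightOf B
  tree-lightest {D} {B} once D≥0 B⊆ sp = begin
    weightOf (map treeEdge D)
      ≡⟨ ∑-map treeEdge D wt ⟩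
    ∑ D (wt ∘ treeEdge)
      ≤⟨ ∑-mono D (λ {d} d∈ → hit (side d) (D≥0 d∈) B (crossed d∈)) ⟩
    ∑ D (λ d → ∑ B (λ b → if crosses (side d) b then wt (treeEdge d) else 0ℚ))
      ≡⟨ ∑-swap D B _ ⟩
    ∑ B (λ b → ∑ D (λ d → if crosses (side d) b then wt (treeEdge d) else 0ℚ))
      ≡⟨ ∑-cong B only ⟩
    weightOf B ∎
    where
    open ℚ.≤-Reasoning

    hit : ∀ g {w} → 0ℚ ≤ w → ∀ B → ¬ All (Respects g) B →
          w ≤ ∑ B (λ b → if crosses g b then w else 0ℚ)
    hit g 0≤w []      ¬all = contradiction [] ¬all
    hit g {w} 0≤w (b ∷ B) ¬all with crosses g b in eq
    ... | true  = p≤p+q w (∑-nonneg B (λ {b} _ → if-nonneg (crosses g b) 0≤w))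
    ... | false = ℚ.≤-trans (hit g 0≤w B (λ all → ¬all (xor-≡ eq ∷ all)))
                    (ℚ.≤-reflexive (sym (ℚ.+-identityˡ _)))

    crossed : ∀ {d} → d ∈ D → ¬ All (Respects (side d)) B
    crossed {d} d∈ flat with e ← All.lookup (proj₁ once) d∈
      rewrite spanning⇒constant sp (side d) flat (src (treeEdge d)) (tgt (treeEdge d))
            | xor-same (side d (tgt (treeEdge d))) with () ← e

    only : ∀ {b} → b ∈ B → ∑ D (λ d → if crosses (side d) b then wt (treeEdge d) else 0ℚ) ≡ wt b
    only b∈ with d , d∈ , refl ← ∈-map⁻ treeEdge (B⊆ b∈) =
      Delta.∑-crossed ℚ.+-0-isCommutativeMonoid once (wt ∘ treeEdge) d∈

  module _ (G : WeightedGraph n) where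

    crossing : Cut n → ℚ → ∀ {a b} → Walk G a b → ℚ
    crossing g φ ε = 0ℚ
    crossing g φ (_◅_ {a} {b} s p) = (if g a xor g b then φ else 0ℚ) + crossing g φ p

    crossing-nonneg : ∀ g {φ} → 0ℚ ≤ φ → ∀ {a b} (p : Walk G a b) → 0ℚ ≤ crossing g φ p
    crossing-nonneg g 0≤φ ε = ℚ.≤-refl
    crossing-nonneg g 0≤φ (_◅_ {a} {b} s p) = ℚ.+-mono-≤ (if-nonneg (g a xor g b) 0≤φ) (crossing-nonneg g 0≤φ p)

    crossing-◅◅ : ∀ g φ {a b c} (p : Walk G a b) (q : Walk G b c) →
                  crossing g φ (p ◅◅ q) ≡ crossing g φ p + crossing g φ q
    crossing-◅◅ g φ ε q = sym (ℚ.+-identityˡ _)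
    crossing-◅◅ g φ (_◅_ {a} {b} s p) q = trans
      (cong ((if g a xor g b then φ else 0ℚ) +_) (crossing-◅◅ g φ p q))
      (sym (ℚ.+-assoc (if g a xor g b then φ else 0ℚ) (crossing g φ p) (crossing g φ q)))

    crossing-≥ : ∀ g {φ} → 0ℚ ≤ φ → ∀ {a b} (p : Walk G a b) → g a ≢ g b → φ ≤ crossing g φ p
    crossing-≥ g 0≤φ ε a≢b = contradiction refl a≢b
    crossing-≥ g {φ} 0≤φ (_◅_ {a} {b} s p) a≢c with g a xor g b in eq
    ... | true  = p≤p+q φ (crossing-nonneg g 0≤φ p)
    ... | false = ℚ.≤-trans (crossing-≥ g 0≤φ p (λ eq′ → a≢c (trans (xor-≡ eq) eq′)))
                            (ℚ.≤-reflexive (sym (ℚ.+-identityˡ _)))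

    crossing-twice : ∀ g {φ} → 0ℚ ≤ φ → ∀ {r} (W : Walk G r r) → (∀ x → Visits G W x) →
                     ∀ x → g r ≢ g x → φ + φ ≤ crossing g φ W
    crossing-twice g {φ} 0≤φ W all x r≢x with p , q , refl ← split-at G (all x) =
      ℚ.≤-trans (ℚ.+-mono-≤ (crossing-≥ g 0≤φ p r≢x) (crossing-≥ g 0≤φ q (r≢x ∘ sym)))
                (ℚ.≤-reflexive (sym (crossing-◅◅ g φ p q)))

    crossing-charge : ∀ D (φ : CutEdge → ℚ) c →
      (∀ a b w → weight G a b ≡ just w → ∑ D (λ d → if side d a xor side d b then φ d else 0ℚ) ≤ c * w) →
      ∀ {a b} (p : Walk G a b) → ∑ D (λ d → crossing (side d) (φ d) p) ≤ c * walkWeight G p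
    crossing-charge D φ c charge ε = ℚ.≤-reflexive (trans (∑-ε D) (sym (ℚ.*-zeroʳ c)))
    crossing-charge D φ c charge (_◅_ {a} {b} (w , eq) p) = begin
      ∑ D (λ d → (if side d a xor side d b then φ d else 0ℚ) + crossing (side d) (φ d) p)
        ≡⟨ ∑-∙ D _ _ ⟩
      ∑ D (λ d → if side d a xor side d b then φ d else 0ℚ) + ∑ D (λ d → crossing (side d) (φ d) p)
        ≤⟨ ℚ.+-mono-≤ (charge a b w eq) (crossing-charge D φ c charge p) ⟩
      c * w + c * walkWeight G p
        ≡⟨ ℚ.*-distribˡ-+ c w (walkWeight G p) ⟨
      c * (w + walkWeight G p) ∎
      where open ℚ.≤-Reasoning

    double-cover : ∀ {D : List (CutEdge {n})} → CrossedOnce D → (φ : CutEdge → ℚ) → (∀ {d} → d ∈ D → 0ℚ ≤ φ d) → ∀ c →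
      (∀ a b w → weight G a b ≡ just w → ∑ D (λ d → if side d a xor side d b then φ d else 0ℚ) ≤ c * w) →
      ∀ {r} (W : Walk G r r) → (∀ x → Visits G W x) → ∑ D φ + ∑ D φ ≤ c * walkWeight G W
    double-cover {D} once φ φ≥0 c charge {r} W all = begin
      ∑ D φ + ∑ D φ                        ≡⟨ ∑-∙ D φ φ ⟨
      ∑ D (λ d → φ d + φ d)                ≤⟨ ∑-mono D twice ⟩
      ∑ D (λ d → crossing (side d) (φ d) W) ≤⟨ crossing-charge D φ c charge W ⟩
      c * walkWeight G W                   ∎
      where
      open ℚ.≤-Reasoning
      twice : ∀ {d} → d ∈ D → φ d + φ d ≤ crossing (side d) (φ d) W
      twice {d} d∈ with side d r Bool.≟ side d (src (treeEdge d))
      ... | no  ≢ = crossing-twice (side d) (φ≥0 d∈) W all _ ≢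
      ... | yes ≡s = crossing-twice (side d) (φ≥0 d∈) W all (tgt (treeEdge d)) λ ≡t →
        contradiction (trans (sym (All.lookup (proj₁ once) d∈))
          (trans (cong (_xor side d (tgt (treeEdge d))) (trans (sym ≡s) ≡t)) (xor-same (side d (tgt (treeEdge d)))))) λ ()

    walk-edges : ∀ {σ} → IsGraphStream G σ → ∀ {a b} (p : Walk G a b) →
      ∃[ B ] B ⊆ σ × weightOf B ≡ walkWeight G p ×
        (∀ (g : Fin n → Fin n) → All (Respects g) B → ∀ {x} → Visits G p x → g x ≡ g a)
    walk-edges str ε = [] , (λ ()) , refl , λ { g _ here → refl }
    walk-edges str (_◅_ {a} {c} (w , eq) p)
      with B , B⊆ , wB , flat ← walk-edges str p | IsGraphStream.complete str a c w eq
    ... | inj₁ e∈ = edge a c w ∷ B , (λ { (here refl) → e∈ ; (there x∈) → B⊆ x∈ }) , cong (_+_ w) wB ,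
                    λ { g _ here → refl ; g (r ∷ rs) (there v) → trans (flat g rs v) (sym r) }
    ... | inj₂ e∈ = edge c a w ∷ B , (λ { (here refl) → e∈ ; (there x∈) → B⊆ x∈ }) , cong (_+_ w) wB ,
                    λ { g _ here → refl ; g (r ∷ rs) (there v) → trans (flat g rs v) r }

    walk-edges-spanning : ∀ {σ} → IsGraphStream G σ → ∀ {r} (W : Walk G r r) → (∀ x → Visits G W x) →
      ∃[ B ] B ⊆ σ × weightOf B ≡ walkWeight G W × Spanning B
    walk-edges-spanning str W all with B , B⊆ , wB , flat ← walk-edges str W =
      B , B⊆ , wB , λ x y → trans (flat (label B) (label-respects B) (all x))
                                  (sym (flat (label B) (label-respects B) (all y)))

    stream-charge : ∀ {σ} → IsGraphStream G σ → ∀ (D : List CutEdge) (φ : CutEdge → ℚ) c →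
      (∀ {e} → e ∈ σ → ∑ D (λ d → if crosses (side d) e then φ d else 0ℚ) ≤ c * wt e) →
      ∀ a b w → weight G a b ≡ just w → ∑ D (λ d → if side d a xor side d b then φ d else 0ℚ) ≤ c * w
    stream-charge str D φ c charge a b w eq with IsGraphStream.complete str a b w eq
    ... | inj₁ e∈ = charge e∈
    ... | inj₂ e∈ = ℚ.≤-trans (ℚ.≤-reflexive (∑-cong D λ {d} _ →
      cong (λ z → if z then φ d else 0ℚ) (xor-comm (side d a) (side d b)))) (charge e∈)

estimate : ∀ {n} → List (StreamEdge n) → List (StreamEdge n) → ℚ
estimate T F = ½ * ((weightOf T + weightOf T) + ((weightOf T + uncoveredWeight (cuts T) F) + weightOf F))

half-double : ∀ t → ½ * (t + t) ≡ t
half-double = solve 1 (λ t → con ½ :* (t :+ t) := t) refl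
  where open +-*-Solver

combine : ∀ τ υ φ t → τ ≤ t → υ + υ ≤ ratio * t → ratio * φ + υ ≤ τ → 0ℚ ≤ t →
          ½ * ((τ + τ) + ((τ + υ) + φ)) ≤ (ℤ.+ 196 / 100) * t
combine τ υ φ t τ≤t 2υ≤ paid 0≤t = begin
  ½ * ((τ + τ) + ((τ + υ) + φ))
    ≡⟨ solve 3 (λ τ υ φ → con ½ :* ((τ :+ τ) :+ ((τ :+ υ) :+ φ)) :=
         con (ℤ.+ 3 / 2) :* τ :+ (con (ℤ.+ 5 / 14) :* (con ratio :* φ :+ υ)
                                  :+ con (ℤ.+ 1 / 14) :* (υ :+ υ))) refl τ υ φ ⟩
  (ℤ.+ 3 / 2) * τ + ((ℤ.+ 5 / 14) * (ratio * φ + υ) + (ℤ.+ 1 / 14) * (υ + υ))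
    ≤⟨ ℚ.+-mono-≤ (ℚ.*-monoˡ-≤-nonNeg (ℤ.+ 3 / 2) τ≤t)
         (ℚ.+-mono-≤ (ℚ.*-monoˡ-≤-nonNeg (ℤ.+ 5 / 14) (ℚ.≤-trans paid τ≤t))
                     (ℚ.*-monoˡ-≤-nonNeg (ℤ.+ 1 / 14) 2υ≤)) ⟩
  (ℤ.+ 3 / 2) * t + ((ℤ.+ 5 / 14) * t + (ℤ.+ 1 / 14) * (ratio * t))
    ≤⟨ p≤p+q _ (ℚ.≤-trans (ℚ.≤-reflexive (sym (ℚ.*-zeroʳ slack))) (ℚ.*-monoˡ-≤-nonNeg slack 0≤t)) ⟩
  ((ℤ.+ 3 / 2) * t + ((ℤ.+ 5 / 14) * t + (ℤ.+ 1 / 14) * (ratio * t))) + slack * t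
    ≡⟨ solve 1 (λ t → (con (ℤ.+ 3 / 2) :* t :+ (con (ℤ.+ 5 / 14) :* t
                         :+ con (ℤ.+ 1 / 14) :* (con ratio :* t))) :+ con slack :* t
         := con (ℤ.+ 196 / 100) :* t) refl t ⟩
  (ℤ.+ 196 / 100) * t ∎
  where
  open ℚ.≤-Reasoning
  open +-*-Solver
  slack : ℚ
  slack = ℤ.+ 1 / 350

module _ {m : ℕ} (G : WeightedGraph (suc m)) {σ} (str : IsGraphStream G σ)
         {T F} (indep : Independent T) (T-in : All (InGraph G) T) (F-in : All (InGraph G) F)
         (minimal : All (Replaceable T) σ)
         (exhausted : ∀ {e} → e ∈ σ → newWeight (cuts T) F e ≤ ratio * wt e)
         (paid : ratio * weightOf F + uncoveredWeight (cuts T) F ≤ weightOf T)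
         {t : ℚ} (tsp : IsTSP G t) where

  private
    D : List CutEdge
    D = cuts T

    once : CrossedOnce D
    once = cuts-crossed-once T indep

    D≡T : map treeEdge D ≡ T
    D≡T = cuts-edges T

    d = proj₁ tsp
    metric = proj₁ (proj₂ tsp)
    t-min = proj₂ (proj₂ (proj₂ tsp))

    D≥0 : ∀ {d} → d ∈ D → 0ℚ ≤ wt (treeEdge d)
    D≥0 d∈ = non-negative G _ _ _ (All.lookup T-in (subst (_ ∈_) D≡T (∈-map⁺ treeEdge d∈)))

    optimum : ∃[ r ] Σ[ W ∈ Walk G r r ] (∀ x → Visits G W x) × walkWeight G W ≡ t
    optimum =
      let (π , eq) , _ = proj₂ (proj₂ tsp)
          r , W , all , wW = tour⇒walk G d metric π
      in r , W , all , trans wW eq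

    W    = proj₁ (proj₂ optimum)
    all  = proj₁ (proj₂ (proj₂ optimum))
    wW≡t = proj₂ (proj₂ (proj₂ optimum))

    light : ∃[ B ] B ⊆ T × Spanning B × weightOf B ≤ t
    light =
      let B , B⊆ , wB , sp = walk-edges-spanning G str W all
          B′ , B′⊆ , sp′ , le = replaceable-list B (All.tabulate (All.lookup minimal ∘ B⊆)) []
             (subst Spanning (sym (++-identityʳ B)) sp)
      in B′ , B′⊆ , subst Spanning (++-identityʳ B′) sp′ ,
        ℚ.≤-trans le (ℚ.≤-reflexive (trans wB wW≡t))

    T-spanning : Spanning (map treeEdge D)
    T-spanning = let B , B⊆ , sp , _ = light in subst Spanning (sym D≡T) (spanning-⊆ B⊆ sp)

    tree≤t : weightOf T ≤ t
    tree≤t = let B , B⊆ , sp , le = light in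
      subst (λ T → weightOf T ≤ t) D≡T (ℚ.≤-trans (tree-lightest once D≥0 (subst (_ ∈_) (sym D≡T) ∘ B⊆) sp) le)

    0≤t : 0ℚ ≤ t
    0≤t = ℚ.≤-trans (walkWeight-nonneg G W) (ℚ.≤-reflexive wW≡t)

    uncovered≤t : uncoveredWeight D F + uncoveredWeight D F ≤ ratio * t
    uncovered≤t = ℚ.≤-trans
      (double-cover G once _ uncovered≥0 ratio (stream-charge G str D _ ratio exhausted) W all)
      (ℚ.≤-reflexive (cong (ratio *_) wW≡t))
      where
      uncovered≥0 : ∀ {d} → d ∈ D → 0ℚ ≤ (if covered F d then 0ℚ else wt (treeEdge d))
      uncovered≥0 {d} d∈ = if-nonneg′ (covered F d) (D≥0 d∈)

    evenCover-in : ∀ {S} → S ⊆ F → All (InGraph G) (evenCover D S)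
    evenCover-in {S} S⊆F = All.++⁺ (subst (All (InGraph G)) (sym D≡T) T-in) (All.++⁺
      (All.tabulate (All.lookup F-in ∘ S⊆F))
      (All.map⁺ (All.filter⁺ (T? ∘ evenly S) (All.map⁻ (subst (All (InGraph G)) (sym D≡T) T-in)))))

  estimate-upper : estimate T F ≤ (ℤ.+ 196 / 100) * t
  estimate-upper = combine (weightOf T) _ (weightOf F) t tree≤t uncovered≤t paid 0≤t

  estimate-lower : t ≤ estimate T F
  estimate-lower =
    let S , S⊆F , le = cheap-evenCover D F
        W , all , wW = euler G (evenCover D S) (evenCover-in S⊆F) (evenCover-even once T-spanning S)
                         (spanning-⊆ {L = map treeEdge D} {L′ = evenCover D S} ∈-++⁺ˡ T-spanning) Fin.zero
        π , wπ = walk⇒tour G d metric W all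
        t≤ = ℚ.≤-trans (t-min π) (ℚ.≤-trans wπ wW)
    in begin
      t            ≡⟨ half-double t ⟨
      ½ * (t + t)  ≤⟨ ℚ.*-monoˡ-≤-nonNeg ½ (ℚ.≤-trans (ℚ.+-mono-≤ t≤ t≤) le) ⟩
      ½ * ((weightOf (map treeEdge D) + weightOf (map treeEdge D)) +
        ((weightOf (map treeEdge D) + uncoveredWeight D F) + weightOf F))
        ≡⟨ cong (λ L → ½ * ((weightOf L + weightOf L) + ((weightOf L + uncoveredWeight D F) + weightOf F))) D≡T ⟩
      estimate T F ∎
    where open ℚ.≤-Reasoning

-- Machine words

toBits : ∀ b → ℕ → Vec Bool b
toBits zero    k = []
toBits (suc b) k = (k ℕ.% 2 ℕ.≡ᵇ 1) ∷ toBits b (k ℕ./ 2)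

fromBits : ∀ {b} → Vec Bool b → ℕ
fromBits []      = 0
fromBits (x ∷ v) = (if x then 1 else 0) ℕ.+ fromBits v ℕ.* 2

fromBits-toBits : ∀ b {k} → k ℕ.< 2 ^ b → fromBits (toBits b k) ≡ k
fromBits-toBits zero    (s≤s z≤n) = refl
fromBits-toBits (suc b) {k} k<    = begin
  (if k ℕ.% 2 ℕ.≡ᵇ 1 then 1 else 0) ℕ.+ fromBits (toBits b (k ℕ./ 2)) ℕ.* 2
    ≡⟨ cong₂ (λ x y → x ℕ.+ y ℕ.* 2) (digit (k ℕ.% 2) (ℕ.m%n<n k 2))
         (fromBits-toBits b (ℕ.m<n*o⇒m/o<n (subst (k ℕ.<_) (ℕ.*-comm 2 (2 ^ b)) k<))) ⟩
  k ℕ.% 2 ℕ.+ k ℕ./ 2 ℕ.* 2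
    ≡⟨ ℕ.m≡m%n+[m/n]*n k 2 ⟨
  k ∎
  where
  open ≡-Reasoning
  digit : ∀ r → r ℕ.< 2 → (if r ℕ.≡ᵇ 1 then 1 else 0) ≡ r
  digit 0 _ = refl
  digit 1 _ = refl
  digit (suc (suc r)) (s≤s (s≤s ()))

n≤2^⌈log₂n⌉ : ∀ n → n ℕ.≤ 2 ^ ⌈log₂ n ⌉
n≤2^⌈log₂n⌉ = <-rec _ go
  where
  open ℕ.≤-Reasoning
  double : ∀ k → 1 ℕ.≤ k → 2 ^ (k ℕ.∸ 1) ℕ.+ 2 ^ (k ℕ.∸ 1) ≡ 2 ^ k
  double (suc k) _ = cong (2 ^ k ℕ.+_) (sym (ℕ.+-identityʳ (2 ^ k)))

  go : ∀ n → (∀ {m} → m ℕ.< n → m ℕ.≤ 2 ^ ⌈log₂ m ⌉) → n ℕ.≤ 2 ^ ⌈log₂ n ⌉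
  go 0 _ = z≤n
  go 1 _ = s≤s z≤n
  go n@(suc (suc m)) rec = begin
    n                      ≡⟨ ℕ.⌊n/2⌋+⌈n/2⌉≡n n ⟨
    ℕ.⌊ n /2⌋ ℕ.+ h        ≤⟨ ℕ.+-monoˡ-≤ h (ℕ.⌊n/2⌋≤⌈n/2⌉ n) ⟩
    h ℕ.+ h                ≤⟨ ℕ.+-mono-≤ (rec (ℕ.⌈n/2⌉<n m)) (rec (ℕ.⌈n/2⌉<n m)) ⟩
    2 ^ ⌈log₂ h ⌉ ℕ.+ 2 ^ ⌈log₂ h ⌉
                           ≡⟨ cong (λ k → 2 ^ k ℕ.+ 2 ^ k) (⌈log₂⌈n/2⌉⌉≡⌈log₂n⌉∸1 n) ⟩
    2 ^ (⌈log₂ n ⌉ ℕ.∸ 1) ℕ.+ 2 ^ (⌈log₂ n ⌉ ℕ.∸ 1)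
                           ≡⟨ double _ (⌈log₂⌉-mono-≤ {2} {n} (s≤s (s≤s z≤n))) ⟩
    2 ^ ⌈log₂ n ⌉          ∎
    where h = ⌈ n /2⌉

module Encoding (n ω : ℕ) where

  W : Set
  W = Word n ω

  number : ℕ → W
  number = toBits _

  -- An edge takes four words; an empty slot has denominator 0.

  toEdge : ℕ → ℕ → ℕ → ℕ → Maybe (StreamEdge n)
  toEdge u v p zero    = nothing
  toEdge u v p (suc q) with u ℕ.<? n | v ℕ.<? n
  ... | yes u< | yes v< = just (edge (fromℕ< u<) (fromℕ< v<) (ℤ.+ p / suc q))
  ... | _      | _      = nothing

  encodeEdges : ∀ k → List (StreamEdge n) → Vec W (k ℕ.* 4)
  encodeEdges zero    _       = []
  encodeEdges (suc k) []      = number 0 ∷ number 0 ∷ number 0 ∷ number 0 ∷ encodeEdges k []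
  encodeEdges (suc k) (e ∷ L) =
    number (toℕ (src e)) ∷ number (toℕ (tgt e)) ∷ number ℤ.∣ ↥ wt e ∣ ∷ number (↧ₙ wt e) ∷ encodeEdges k L

  consMaybe : {A : Set} → Maybe A → List A → List A
  consMaybe nothing  L = L
  consMaybe (just e) L = e ∷ L

  decodeEdges : ∀ k → Vec W (k ℕ.* 4) → List (StreamEdge n)
  decodeEdges zero    _                   = []
  decodeEdges (suc k) (u ∷ v ∷ p ∷ q ∷ m) =
    consMaybe (toEdge (fromBits u) (fromBits v) (fromBits p) (fromBits q)) (decodeEdges k m)

  Fits : StreamEdge n → Set
  Fits e = 0ℚ ≤ wt e × ℤ.∣ ↥ wt e ∣ ℕ.< 2 ^ ω × ↧ₙ wt e ℕ.< 2 ^ ω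

  toEdge-correct : ∀ e → 0ℚ ≤ wt e → toEdge (toℕ (src e)) (toℕ (tgt e)) ℤ.∣ ↥ wt e ∣ (↧ₙ wt e) ≡ just e
  toEdge-correct (edge u v w@(mkℚ ℤ.-[1+ _ ] _ _)) 0≤w with () ← ℚ.nonNegative 0≤w
  toEdge-correct (edge u v w@(mkℚ (ℤ.+ _) _ _)) 0≤w with toℕ u ℕ.<? n | toℕ v ℕ.<? n
  ... | yes u< | yes v< = cong just (trans
    (cong₂ (λ u v → edge u v _) (Fin.fromℕ<-toℕ u u<) (Fin.fromℕ<-toℕ v v<))
    (cong (edge u v) (ℚ.↥p/↧p≡p w)))
  ... | no u≮  | _      = contradiction (Fin.toℕ<n u) u≮
  ... | yes _  | no v≮  = contradiction (Fin.toℕ<n v) v≮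

  number-vertex : ∀ (u : Fin n) → fromBits (number (toℕ u)) ≡ toℕ u
  number-vertex u = fromBits-toBits (⌈log₂ n ⌉ ℕ.+ ω) (ℕ.≤-trans (Fin.toℕ<n u)
    (ℕ.≤-trans (n≤2^⌈log₂n⌉ n) (ℕ.^-monoʳ-≤ 2 (ℕ.m≤m+n ⌈log₂ n ⌉ ω))))

  number-bounded : ∀ {k} → k ℕ.< 2 ^ ω → fromBits (number k) ≡ k
  number-bounded k< = fromBits-toBits (⌈log₂ n ⌉ ℕ.+ ω)
    (ℕ.≤-trans k< (ℕ.^-monoʳ-≤ 2 (ℕ.m≤n+m ω ⌈log₂ n ⌉)))

  number-zero : fromBits (number 0) ≡ 0
  number-zero = fromBits-toBits (⌈log₂ n ⌉ ℕ.+ ω) (ℕ.m^n>0 2 (⌈log₂ n ⌉ ℕ.+ ω))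

  decode-encodeEdges : ∀ k {L} → length L ℕ.≤ k → All Fits L → decodeEdges k (encodeEdges k L) ≡ L
  decode-encodeEdges zero    z≤n      []                      = refl
  decode-encodeEdges (suc k) z≤n      []
    rewrite number-zero = decode-encodeEdges k z≤n []
  decode-encodeEdges (suc k) {e ∷ L} (s≤s l) ((0≤ , num , den) ∷ fs)
    rewrite number-vertex (src e) | number-vertex (tgt e) | number-bounded num | number-bounded den
          | toEdge-correct e 0≤ = cong (e ∷_) (decode-encodeEdges k l fs)

  Lists : Set
  Lists = List (StreamEdge n) × List (StreamEdge n)

  Mem : Set
  Mem = Vec W (n ℕ.* 4 ℕ.+ n ℕ.* 4)

  encode : Lists → Mem
  encode (T , F) = encodeEdges n T Vec.++ encodeEdges n F

  decode : Mem → Lists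
  decode m = decodeEdges n (Vec.take (n ℕ.* 4) m) , decodeEdges n (Vec.drop (n ℕ.* 4) m)

  Storable : List (StreamEdge n) → Set
  Storable L = length L ℕ.≤ n × All Fits L

  decode-encode : ∀ {T F} → Storable T → Storable F → decode (encode (T , F)) ≡ (T , F)
  decode-encode {T} {F} (lT , fT) (lF , fF) = cong₂ _,_
    (trans (cong (decodeEdges n) (proj₁ parts)) (decode-encodeEdges n lT fT))
    (trans (cong (decodeEdges n) (proj₂ parts)) (decode-encodeEdges n lF fF))
    where
    parts = Vec.++-injective (Vec.take (n ℕ.* 4) (encode (T , F))) (encodeEdges n T)
      (Vec.take++drop≡id (n ℕ.* 4) (encode (T , F)))

  update : Fin 2 → Lists → StreamEdge n → Lists
  update Fin.zero           (T , F) f = prune (insert f T) , F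
  update (Fin.suc Fin.zero) (T , F) f = T , cover (cuts T) F f

  stepMem : Fin 2 → Mem → StreamEdge n → Mem
  stepMem i m f = encode (update i (decode m) f)

  stepMem-encode : ∀ i {T F} f → Storable T → Storable F →
                   stepMem i (encode (T , F)) f ≡ encode (update i (T , F) f)
  stepMem-encode i f sT sF = cong (λ s → encode (update i s f)) (decode-encode sT sF)

  outputMem : Mem → ℚ
  outputMem m = estimate (proj₁ (decode m)) (proj₂ (decode m))

  outputMem-encode : ∀ {T F} → Storable T → Storable F → outputMem (encode (T , F)) ≡ estimate T F
  outputMem-encode sT sF = cong (λ s → estimate (proj₁ s) (proj₂ s)) (decode-encode sT sF)

  algorithm : StreamingAlgorithm 2 (n ℕ.* 4 ℕ.+ n ℕ.* 4) n ω
  algorithm = record { start = encode ([] , []) ; step = stepMem ; output = outputMem }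

  module _ (G : WeightedGraph n) (fit : WeightsFit ω G) where

    in⇒fits : ∀ {e} → InGraph G e → Fits e
    in⇒fits {e} ok = non-negative G (src e) (tgt e) (wt e) ok , fit (src e) (tgt e) (wt e) ok

    in⇒nonneg : ∀ {e} → InGraph G e → 0ℚ ≤ wt e
    in⇒nonneg {e} = non-negative G (src e) (tgt e) (wt e)

    record Forest (T : List (StreamEdge n)) : Set where
      field
        independent : Independent T
        descending  : Descending T
        in-graph    : All (InGraph G) T

      storable : Storable T
      storable = independent⇒length≤ independent , All.map in⇒fits in-graph

    open Forest

    []-storable : Storable []
    []-storable = z≤n , []

    grow : ∀ {T f} → Forest T → InGraph G f →
           Forest (prune (insert f T)) × All (Replaceable (prune (insert f T))) (insert f T)
    grow {T} {f} forest ok = record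
      { independent = prune-independent (insert f T)
      ; descending  = prune-descending (insert-descending (descending forest))
      ; in-graph    = All.tabulate (All.lookup inserted ∘ prune-⊆ (insert f T))
      } , prune-replaceable (All.map in⇒nonneg inserted) (insert-descending (descending forest))
      where
      inserted = insert-All ok (in-graph forest)

    first-pass : ∀ σ {T} → All (InGraph G) σ → Forest T →
      ∃[ T′ ] foldl (stepMem Fin.zero) (encode (T , [])) σ ≡ encode (T′ , []) × Forest T′ ×
        All (Replaceable T′) σ × (∀ {a} → Replaceable T a → Replaceable T′ a)
    first-pass []      {T} []         forest = T , refl , forest , [] , id
    first-pass (f ∷ σ) {T} (ok ∷ oks) forest =
      let forest₁ , rep = grow forest ok
          T′ , eq , forest′ , reps , keep = first-pass σ oks forest₁
      in T′ , trans (cong (λ m → foldl (stepMem Fin.zero) m σ)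
                        (stepMem-encode Fin.zero f (storable forest) []-storable)) eq ,
         forest′ ,
         keep (All.lookup rep (insert-⊇ f T (here refl))) ∷ reps ,
         λ {a} r → keep (replaceable-trans {a = a} r (All.tabulate (λ x∈ → All.lookup rep (insert-⊇ f T (there x∈)))))

    module _ {T} (forest : Forest T) where

      private
        D = cuts T

        D≥0 : ∀ {d} → d ∈ D → 0ℚ ≤ wt (treeEdge d)
        D≥0 d∈ = in⇒nonneg (All.lookup (in-graph forest) (subst (_ ∈_) (cuts-edges T) (∈-map⁺ treeEdge d∈)))

      record PartialCover (F : List (StreamEdge n)) : Set where
        field
          affordable : Paid D D≥0 F
          in-graph′  : All (InGraph G) F
          short      : length F ℕ.+ uncoveredCount D F ℕ.≤ length D

        storable′ : Storable F
        storable′ = ℕ.≤-trans (ℕ.m≤m+n (length F) _) (ℕ.≤-trans short (subst (ℕ._≤ n)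
            (trans (cong length (sym (cuts-edges T))) (length-map treeEdge D)) (proj₁ (storable forest)))) ,
          All.map in⇒fits in-graph′

      open PartialCover

      []-cover : PartialCover []
      []-cover = record
        { affordable = paid-[] D D≥0 ; in-graph′ = [] ; short = ℕ.≤-reflexive (uncoveredCount-[] D) }

      cover-All : ∀ {P : StreamEdge n → Set} {F f} → P f → All P F → All P (cover D F f)
      cover-All {F = F} {f} p ps with ratio * wt f ℚ.<? newWeight D F f
      ... | yes _ = p ∷ ps
      ... | no  _ = ps

      cover-partial : ∀ {F f} → PartialCover F → InGraph G f → PartialCover (cover D F f)
      cover-partial {F} {f} part ok = record
        { affordable = cover-paid D D≥0 f (affordable part)
        ; in-graph′  = cover-All ok (in-graph′ part)
        ; short      = cover-length f (in⇒nonneg ok) (short part)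
        }

      second-pass : ∀ σ {F} → All (InGraph G) σ → PartialCover F →
        ∃[ F′ ] foldl (stepMem (Fin.suc Fin.zero)) (encode (T , F)) σ ≡ encode (T , F′) × PartialCover F′ ×
          All (Exhausted D D≥0 F′) σ × (∀ {e} → Exhausted D D≥0 F e → Exhausted D D≥0 F′ e)
      second-pass []      {F} []         part = F , refl , part , [] , id
      second-pass (f ∷ σ) {F} (ok ∷ oks) part =
        let F′ , eq , part′ , exs , keep = second-pass σ oks (cover-partial part ok)
        in F′ , trans (cong (λ m → foldl (stepMem (Fin.suc Fin.zero)) m σ)
                        (stepMem-encode (Fin.suc Fin.zero) f (storable forest) (storable′ part))) eq ,
           part′ ,
           keep {f} (cover-exhausted-self D D≥0 {F} f (in⇒nonneg ok)) ∷ exs ,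
           λ {e} ex → keep {e} (cover-exhausted D D≥0 {F} f {e} ex)

    run-correct : ∀ {σ} → IsGraphStream G σ → ∃[ T ] ∃[ F ] Σ[ forest ∈ Forest T ]
      All (Replaceable T) σ × PartialCover forest F ×
      All (λ e → newWeight (cuts T) F e ≤ ratio * wt e) σ × run algorithm σ ≡ estimate T F
    run-correct {σ} str =
      let T , eq₁ , forest , reps , _ = first-pass σ sound []-forest
          F , eq₂ , part , exs , _    = second-pass forest σ sound ([]-cover forest)
      in T , F , forest , reps , part , exs ,
         trans (cong (λ m → outputMem (foldl (stepMem (Fin.suc Fin.zero)) m σ)) eq₁)
           (trans (cong outputMem eq₂) (outputMem-encode (storable forest) (PartialCover.storable′ part)))
      where
      sound = IsGraphStream.sound str
      []-forest : Forest []
      []-forest = record { independent = tt ; descending = [] ; in-graph = [] }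

algorithm-correct :
  ∀ n ω (G : WeightedGraph n) → WeightsFit ω G → ∀ σ → IsGraphStream G σ → ∀ t → IsTSP G t →
  t ≤ run (Encoding.algorithm n ω) σ × run (Encoding.algorithm n ω) σ ≤ (ℤ.+ 196 / 100) * t
algorithm-correct zero ω G fit [] str t (d , metric , (π , refl) , _) = ℚ.≤-refl , ℚ.≤-refl
algorithm-correct zero ω G fit (edge () _ _ ∷ _) str t tsp
algorithm-correct (suc m) ω G fit σ str t tsp =
  let T , F , forest , reps , part , exs , eq = Encoding.run-correct (suc m) ω G fit str
      open Encoding.Forest forest
      open Encoding.PartialCover part
      paid = ℚ.≤-trans affordable (ℚ.≤-reflexive (cong weightOf (cuts-edges T)))
      lower = estimate-lower G str independent in-graph in-graph′ reps (All.lookup exs) paid tsp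
      upper = estimate-upper G str independent in-graph in-graph′ reps (All.lookup exs) paid tsp
  in ℚ.≤-trans lower (ℚ.≤-reflexive (sym eq)) , ℚ.≤-trans (ℚ.≤-reflexive eq) upper

memory : ℕ → ℕ
memory n = n ℕ.* 4 ℕ.+ n ℕ.* 4

memory∈Õ : memory ∈Õ id
memory∈Õ = 8 , 0 , λ n → ℕ.≤-reflexive (trans (sym (ℕ.*-distribˡ-+ n 4 4))
  (trans (ℕ.*-comm n 8) (sym (ℕ.*-identityʳ (8 ℕ.* n)))))

open ℤ using (+_)

theorem1p6 : ∃[ s ] s ∈Õ id ×
    (Σ[ A ∈ (∀ n ω → StreamingAlgorithm 2 (s n) n ω) ]
    (∀ n ω (G : WeightedGraph n) → Connected G → WeightsFit ω G →
    ∀ (σ : List (StreamEdge n)) → IsGraphStream G σ →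
    ∀ (t : ℚ) → IsTSP G t →
    t ≤ run (A n ω) σ × run (A n ω) σ ≤ (+ 196 / 100) * t))
theorem1p6 = memory , memory∈Õ , Encoding.algorithm ,
  λ n ω G _ fit σ str t tsp → algorithm-correct n ω G fit σ str t tsp
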